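{- Let $p>3$ be a prime. Then $$\sum_{k=0}^{(p-1)/2}(21k+8)\binom{2k}{k}^3\equiv 8p+(-1)^{(p-1)/2}32p^3E_{p-3}\pmod{p^4}$$ and $$\sum_{k=1}^{(p-1)/2}\frac{21k-8}{k^3\binom{2k}{k}^3}\equiv(-1)^{(p+1)/2}4E_{p-3}\pmod p.$$
   Context: The Euler numbers $E_0,E_1,E_2,\ldots$ are the integers given by $E_0=1$ and the recursion $\sum_{0\leqslant k\leqslant n,\ 2\mid k}\binom{n}{k}E_{n-k}=0$ for $n=1,2,3,\ldots$. Congruences modulo a power $p^a$ between rational numbers are understood in the ring of rational numbers whose denominators are not divisible by $p$. -}

module Defs where

open import Data.Bool.Base using (if_then_else_)
open import Data.Fin.Base using (toℕ)
open import Data.Integer.Base as ℤ using (ℤ; +_; 0ℤ; 1ℤ)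
import Data.Integer.Properties as ℤ
open import Data.Nat.Base as ℕ using (ℕ; zero; suc; _∸_; _≤_; _!; NonZero; >-nonZero)
open import Data.Nat.Combinatorics using (_C_; k![n∸k]!∣n!; nCk≡n!/k![n-k]!)
open import Data.Nat.Divisibility using (_∣_; _∣?_; ∣⇒≤)
open import Data.Nat.DivMod using (m≥n⇒m/n>0)
import Data.Nat.Properties as ℕ
open import Data.Product.Base using (_×_; ∃-syntax)
open import Data.Rational.Base as ℚ using (ℚ; ↧ₙ_)
import Data.Rational.Properties as ℚ
open import Function.Base using (_∘_)
open import Relation.Nullary.Decidable.Core using (does)
open import Relation.Nullary.Negation.Core using (¬_)
open import Relation.Binary.PropositionalEquality

import Algebra.Properties.CommutativeMonoid.Sum ℤ.+-0-commutativeMonoid as ℤSum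
import Algebra.Properties.CommutativeMonoid.Sum ℚ.+-0-commutativeMonoid as ℚSum

infixl 10 ∑ℤ ∑ℚ

∑ℤ : ℕ → (ℕ → ℤ) → ℤ
∑ℤ n f = ℤSum.sum {n} (f ∘ toℕ)

∑ℚ : ℕ → (ℕ → ℚ) → ℚ
∑ℚ n f = ℚSum.sum {n} (f ∘ toℕ)

syntax ∑ℤ n (λ k → x) = ∑ℤ[ k < n ] x
syntax ∑ℚ n (λ k → x) = ∑ℚ[ k < n ] x

-- eulerTable n i is E_{n ∸ i}.  The entry E_{n + 1} isolates the k = 0
-- term of the defining recursion: it is minus the sum of
-- C(n + 1, k) E_{n + 1 - k} over the even k with 1 ≤ k ≤ n + 1, where
-- k = j + 1.
eulerTable : ℕ → ℕ → ℤ
eulerTable zero    _       = 1ℤ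
eulerTable (suc n) zero    = ℤ.- (∑ℤ[ j < suc n ]
  (if does (2 ∣? suc j) then + (suc n C suc j) ℤ.* eulerTable n j else 0ℤ))
eulerTable (suc n) (suc i) = eulerTable n i

E : ℕ → ℤ
E n = eulerTable n 0

eulerTable-∸ : ∀ n i → eulerTable n i ≡ E (n ∸ i)
eulerTable-∸ zero    zero    = refl
eulerTable-∸ zero    (suc i) = refl
eulerTable-∸ (suc n) zero    = refl
eulerTable-∸ (suc n) (suc i) = eulerTable-∸ n i

-- E-zero and E-recursion determine E uniquely.
E-zero : E 0 ≡ 1ℤ
E-zero = refl

E-recursion : ∀ n → .{{_ : NonZero n}} →
  (∑ℤ[ k < suc n ] (if does (2 ∣? k) then + (n C k) ℤ.* E (n ∸ k) else 0ℤ)) ≡ 0ℤ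
E-recursion (suc n) = begin
  + 1 ℤ.* E (suc n) ℤ.+ S   ≡⟨ cong (ℤ._+ S) (ℤ.*-identityˡ (E (suc n))) ⟩
  ℤ.- T ℤ.+ S               ≡⟨ cong (λ s → ℤ.- T ℤ.+ s) S≡T ⟩
  ℤ.- T ℤ.+ T               ≡⟨ ℤ.+-inverseˡ T ⟩
  0ℤ                        ∎
  where
  open ≡-Reasoning
  S T : ℤ
  S = ∑ℤ[ j < suc n ]
    (if does (2 ∣? suc j) then + (suc n C suc j) ℤ.* E (n ∸ j) else 0ℤ)
  T = ∑ℤ[ j < suc n ]
    (if does (2 ∣? suc j) then + (suc n C suc j) ℤ.* eulerTable n j else 0ℤ)
  S≡T : S ≡ T
  S≡T = ℤSum.sum-cong-≗ {suc n} λ i →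
    cong (λ e → if does (2 ∣? suc (toℕ i)) then + (suc n C suc (toℕ i)) ℤ.* e else 0ℤ)
         (sym (eulerTable-∸ n (toℕ i)))

fromℤ : ℤ → ℚ
fromℤ z = z ℚ./ 1

-- Elements of ℚ are in lowest terms, so for prime p this is membership
-- in the localisation of ℤ at p.
Integral : ℕ → ℚ → Set
Integral p x = ¬ (p ∣ ↧ₙ x)

infix 4 _≡_[mod_^_]

_≡_[mod_^_] : ℚ → ℚ → ℕ → ℕ → Set
x ≡ y [mod p ^ a ] = Integral p x × Integral p y ×
  ∃[ c ] Integral p c × x ℚ.- y ≡ fromℤ (+ (p ℕ.^ a)) ℚ.* c

nCk≢0 : ∀ {n k} → k ≤ n → NonZero (n C k)
nCk≢0 {n} {k} k≤n = subst NonZero (sym (nCk≡n!/k![n-k]! k≤n))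
  (>-nonZero (m≥n⇒m/n>0 (∣⇒≤ (k![n∸k]!∣n! k≤n))))
  where instance
    _ = n ℕ.!≢0
    _ = k ℕ.!* (n ∸ k) !≢0

reciprocalTerm : (k : ℕ) → .{{_ : NonZero k}} → ℚ
reciprocalTerm k =
  (+ 21 ℤ.* + k ℤ.- + 8) ℚ./ (k ℕ.^ 3 ℕ.* ((2 ℕ.* k) C k) ℕ.^ 3)
  where instance
    _ = nCk≢0 (ℕ.m≤m+n k (k ℕ.+ 0))
    _ = ℕ.m^n≢0 k 3
    _ = ℕ.m^n≢0 ((2 ℕ.* k) C k) 3
    _ = ℕ.m*n≢0 (k ℕ.^ 3) (((2 ℕ.* k) C k) ℕ.^ 3)

{-# OPTIONS --safe #-}

-- With b(n) = Σ_{k≤n} C(n+k,k)², creative telescoping gives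
--   Σ_{k≤n} (21k+8) C(2k,k)³ = 8 (2n+1) C(2n,n) b(n).
-- Repeated summation by parts turns b(n) into (-1)ⁿ Σ_{j≤n} (-1)ʲ C(2n+1,j) C(n+j,j).
-- For p = 2m+1 embed the latter, at n = m, in the family
--   A(n) = (-1)ⁿ C(p-1,n) Σ_{j≤n} (-1)ʲ C(p,j) C(p-1-n+j,j),    A(0) = 1,
-- whose increments are explicit multiples of p².  They give
--   A(m) ≡ 1 + 2p² Σ_{k≤m} (-1)ᵏ/k²  (mod p³),
-- and the sum on the right is 2 (-1)ᵐ E_{p-3} modulo p, because the alternating power sums
-- Σ_{|i|≤m} (-1)^(m+i) (2i)ⁿ satisfy the recursion of the Euler numbers modulo p.
--
-- At n = p - 1 the first identity shows that the sum over all k < p is 8p modulo p⁴.  Its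
-- terms with k > m are those of the second sum, up to the factor 8p³, by
--   k C(2k,k) C(2p-2k,p-k) ≡ -2p  (mod p²),
-- so the second congruence is the complement of the first one.

module Submission where

open import Defs
import Data.Integer.Properties as ℤ
open import Algebra.Properties.CommutativeMonoid.Sum ℤ.+-0-commutativeMonoid using (∑-distrib-+)
open import Algebra.Properties.Semiring.Sum ℤ.+-*-semiring using (*-distribˡ-sum)
import Algebra.Properties.CommutativeSemiring.Binomial ℤ.+-*-commutativeSemiring as Binomial
import Algebra.Properties.Semiring.Exp ℤ.+-*-semiring as Exp
import Algebra.Properties.Semiring.Mult ℤ.+-*-semiring as Mult
open import Data.Bool.Base using (true; false; if_then_else_)
open import Data.Fin.Base using (toℕ)
open import Data.Integer.Base as ℤ using (ℤ; +_; -1ℤ; 0ℤ; 1ℤ; _+_; _*_; _^_; _-_; -_; ∣_∣)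
import Data.Integer.Divisibility.Signed as ℤₛ
open import Data.Integer.GCD using (gcd)
open import Data.Integer.Tactic.RingSolver using (solve-∀)
open import Data.Nat.Base as ℕ using (ℕ; zero; suc; _∸_; _<_; _≤_; s≤s; z≤n; NonZero)
open import Data.Nat.Combinatorics using (_C_; nCn≡1; nC1≡n; nCk≡nC[n∸k]; nCk+nC[k+1]≡[n+1]C[k+1])
open import Data.Nat.Combinatorics.Specification using (k>n⇒nCk≡0)
open import Data.Nat.Coprimality as Coprimality using (Coprime; coprime-divisor)
open import Data.Nat.Divisibility using (_∣_; _∣?_; divides; >⇒∤; ∣-refl; ∣-trans; _∣0; ∣m∣n⇒∣m+n; ∣m+n∣m⇒∣n; ∣n⇒∣m*n)
open import Data.Nat.DivMod using (_/_; _%_; m*n/n≡m; m%n<n; m≡m%n+[m/n]*n)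
open import Data.Nat.Induction using (<-rec)
open import Data.Nat.Primality using (Prime; euclidsLemma; prime⇒irreducible)
import Data.Nat.Properties as ℕ
import Data.Nat.Tactic.RingSolver as ℕRing
open import Data.Product.Base using (_×_; _,_; ∃-syntax)
open import Data.Rational.Base as ℚ using (ℚ; ↧ₙ_; toℚᵘ)
import Data.Rational.Properties as ℚ
open import Data.Rational.Solver using (module +-*-Solver)
open import Data.Rational.Unnormalised.Base as ℚᵘ using (mkℚᵘ; *≡*)
import Data.Rational.Unnormalised.Properties as ℚᵘ
open import Data.Sum.Base using (_⊎_; inj₁; inj₂; [_,_]′)
open import Function.Base using (_∘_)
open import Level using (0ℓ)
open import Relation.Binary.Bundles using (Setoid)
open import Relation.Binary.PropositionalEquality
open import Relation.Nullary.Decidable using (dec-true; dec-false)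
open import Relation.Nullary.Decidable.Core using (does)
open import Relation.Nullary.Negation.Core using (¬_; contradiction)

-- Finite sums

-- The first identity leaves one unknown, b(m) modulo p³; the fourth factor p is the 2m + 1 in front
-- of it. No comparison of b(m) with a neighbouring b(n) helps, as those increments carry no power
-- of p. In A(n) the row p stays fixed while the cut-off n and the second parameter q = p - 1 - n
-- move against each other. The inner sum is a truncated 2F1, and a contiguous relation in q cancels
-- the bulk of A(n+1) - A(n), leaving boundary terms. One factor p in these comes from C(p,n+1) =
-- p/(n+1) C(p-1,n), the other from (n+1) + (p-1-n) = p. Inverses modulo p are represented by
-- integers, 1/k² by k^(p-3), so that everything up to the final passage to the rational sum takes
-- place in the integers.

∑-cong : ∀ n {f g : ℕ → ℤ} → (∀ i → i < n → f i ≡ g i) → ∑ℤ n f ≡ ∑ℤ n g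
∑-cong zero    f≡g = refl
∑-cong (suc n) f≡g = cong₂ _+_ (f≡g 0 (s≤s z≤n)) (∑-cong n λ i i<n → f≡g (suc i) (s≤s i<n))

∑-last : ∀ n (f : ℕ → ℤ) → ∑ℤ (suc n) f ≡ ∑ℤ n f + f n
∑-last zero    f = ℤ.+-comm (f 0) 0ℤ
∑-last (suc n) f = trans (cong (_+_ (f 0)) (∑-last n (f ∘ suc))) (sym (ℤ.+-assoc (f 0) _ _))

∑-+ : ∀ n (f g : ℕ → ℤ) → (∑ℤ[ i < n ] (f i + g i)) ≡ ∑ℤ n f + ∑ℤ n g
∑-+ n f g = ∑-distrib-+ {n} (f ∘ toℕ) (g ∘ toℕ)

∑-*ˡ : ∀ n c (f : ℕ → ℤ) → (∑ℤ[ i < n ] (c * f i)) ≡ c * ∑ℤ n f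
∑-*ˡ n c f = sym (*-distribˡ-sum {n} c (f ∘ toℕ))

-- Reduces x ≡ y to a ring identity: c is the multiplier of the known equation a ≡ b.
≡-combine : ∀ {x y a b} c → a ≡ b → x ≡ y + c * (a - b) → x ≡ y
≡-combine {x} {y} {a} c refl eq = trans eq (ring y a c)
  where
  ring : ∀ y a c → y + c * (a - a) ≡ y
  ring = solve-∀

-- Congruences

infix 4 _≈_[_]

-- With the quotient as data, matching on `q , refl` substitutes the left side away and leaves a
-- ring identity for the solver.
record _≈_[_] (x y M : ℤ) : Set where
  constructor _,_
  field
    quotient : ℤ
    equality : x ≡ y + quotient * M

≈-reflexive : ∀ {M x y} → x ≡ y → x ≈ y [ M ]
≈-reflexive {M} {x} refl = 0ℤ , ring x M
  where
  ring : ∀ x M → x ≡ x + 0ℤ * M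
  ring = solve-∀

≈-refl : ∀ {M x} → x ≈ x [ M ]
≈-refl = ≈-reflexive refl

≈-sym : ∀ {M x y} → x ≈ y [ M ] → y ≈ x [ M ]
≈-sym {M} {_} {y} (q , refl) = - q , ring y q M
  where
  ring : ∀ y q M → y ≡ y + q * M + (- q) * M
  ring = solve-∀

≈-trans : ∀ {M x y z} → x ≈ y [ M ] → y ≈ z [ M ] → x ≈ z [ M ]
≈-trans {M} {_} {_} {z} (q , refl) (r , refl) = r + q , ring z q r M
  where
  ring : ∀ z q r M → z + r * M + q * M ≡ z + (r + q) * M
  ring = solve-∀

≈-setoid : ℤ → Setoid 0ℓ 0ℓ
≈-setoid M = record
  { Carrier       = ℤ
  ; _≈_           = _≈_[ M ]
  ; isEquivalence = record { refl = ≈-refl ; sym = ≈-sym ; trans = ≈-trans }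
  }

+-≈ : ∀ {M x y u v} → x ≈ y [ M ] → u ≈ v [ M ] → x + u ≈ y + v [ M ]
+-≈ {M} {_} {y} {_} {v} (q , refl) (r , refl) = q + r , ring y v q r M
  where
  ring : ∀ y v q r M → y + q * M + (v + r * M) ≡ y + v + (q + r) * M
  ring = solve-∀

*-≈ : ∀ {M x y u v} → x ≈ y [ M ] → u ≈ v [ M ] → x * u ≈ y * v [ M ]
*-≈ {M} {_} {y} {_} {v} (q , refl) (r , refl) = y * r + q * v + q * r * M , ring y v q r M
  where
  ring : ∀ y v q r M → (y + q * M) * (v + r * M) ≡ y * v + (y * r + q * v + q * r * M) * M
  ring = solve-∀

+-≈ˡ : ∀ {M u v} x → u ≈ v [ M ] → x + u ≈ x + v [ M ]
+-≈ˡ x = +-≈ (≈-refl {x = x})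

*-≈ˡ : ∀ {M u v} x → u ≈ v [ M ] → x * u ≈ x * v [ M ]
*-≈ˡ x = *-≈ (≈-refl {x = x})

^-≈ : ∀ {M x y} n → x ≈ y [ M ] → x ^ n ≈ y ^ n [ M ]
^-≈ zero    x≈y = ≈-refl
^-≈ (suc n) x≈y = *-≈ x≈y (^-≈ n x≈y)

∑-≈ : ∀ {M} n {f g : ℕ → ℤ} → (∀ i → i < n → f i ≈ g i [ M ]) → ∑ℤ n f ≈ ∑ℤ n g [ M ]
∑-≈ zero    f≈g = ≈-refl
∑-≈ (suc n) f≈g = +-≈ (f≈g 0 (s≤s z≤n)) (∑-≈ n λ i i<n → f≈g (suc i) (s≤s i<n))

-- The counterpart of `≡-combine`: `c` multiplies the known congruence, `d` collects the explicit
-- multiple of the modulus.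
≈-combine : ∀ {M x y a b} c d → a ≈ b [ M ] → x ≡ y + c * (a - b) + d * M → x ≈ y [ M ]
≈-combine {M} {_} {y} {_} {b} c d (q , refl) refl = c * q + d , ring y b c d q M
  where
  ring : ∀ y b c d q M → y + c * (b + q * M - b) + d * M ≡ y + (c * q + d) * M
  ring = solve-∀

≈-weaken : ∀ {K M x y} → x ≈ y [ K * M ] → x ≈ y [ M ]
≈-weaken {K} {M} {_} {y} (q , refl) = q * K , cong (_+_ y) (sym (ℤ.*-assoc q K M))

≈-scale : ∀ {M x y} K → x ≈ y [ M ] → K * x ≈ K * y [ K * M ]
≈-scale {M} {_} {y} K (q , refl) = q , ring K y q M
  where
  ring : ∀ K y q M → K * (y + q * M) ≡ K * y + q * (K * M)
  ring = solve-∀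

-- The factor leaves the modulus as well, so it may be `p` itself; `≈-cancelˡ` keeps the modulus and
-- asks for coprimality.
≈-unscale : ∀ {M x y} K → .{{_ : ℤ.NonZero K}} → K * x ≈ K * y [ K * M ] → x ≈ y [ M ]
≈-unscale {M} {x} {y} K (q , eq) = q ,
  ℤ.*-cancelˡ-≡ K x (y + q * M) (trans eq (ring K y q M))
  where
  ring : ∀ K y q M → K * y + q * (K * M) ≡ K * (y + q * M)
  ring = solve-∀

≈⇒∣ : ∀ {M x} → x ≈ 0ℤ [ M ] → ∣ M ∣ ∣ ∣ x ∣
≈⇒∣ {M} (q , refl) = ℤₛ.∣⇒∣ᵤ (ℤₛ.divides q (ℤ.+-identityˡ (q * M)))

∣⇒≈ : ∀ {M x} → ∣ M ∣ ∣ ∣ x ∣ → x ≈ 0ℤ [ M ]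
∣⇒≈ {M} {x} M∣x with ℤₛ.∣ᵤ⇒∣ {M} {x} M∣x
... | ℤₛ.divides q eq = q , trans eq (sym (ℤ.+-identityˡ (q * M)))

≈⇒-≈0 : ∀ {M x y} → x ≈ y [ M ] → x - y ≈ 0ℤ [ M ]
≈⇒-≈0 {M} {_} {y} (q , refl) = q , ring y q M
  where
  ring : ∀ y q M → y + q * M - y ≡ 0ℤ + q * M
  ring = solve-∀

-≈0⇒≈ : ∀ {M x y} → x - y ≈ 0ℤ [ M ] → x ≈ y [ M ]
-≈0⇒≈ {M} {x} {y} (q , eq) = q , trans (ring x y) (trans (cong (_+_ y) eq) (cong (_+_ y) (ℤ.+-identityˡ _)))
  where
  ring : ∀ x y → x ≡ y + (x - y)
  ring = solve-∀

≈-cancelˡ : ∀ {M x y} d → Coprime ∣ M ∣ ∣ d ∣ → d * x ≈ d * y [ M ] → x ≈ y [ M ]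
≈-cancelˡ {M} {x} {y} d cop dx≈dy = -≈0⇒≈ (∣⇒≈ (coprime-divisor cop
  (subst (∣ M ∣ ∣_) (ℤ.abs-* d (x - y))
    (≈⇒∣ (≈-trans (≈-reflexive (ring d x y)) (≈⇒-≈0 dx≈dy))))))
  where
  ring : ∀ d x y → d * (x - y) ≡ d * x - d * y
  ring = solve-∀

coprime-*ˡ : ∀ {m n d} → Coprime m d → Coprime n d → Coprime (m ℕ.* n) d
coprime-*ˡ cm cn (i∣mn , i∣d) = cn (coprime-divisor
  (λ (j∣i , j∣m) → cm (j∣m , ∣-trans j∣i i∣d)) i∣mn , i∣d)

coprime-^ˡ : ∀ {m d} a → Coprime m d → Coprime (m ℕ.^ a) d
coprime-^ˡ zero    c = Coprimality.1-coprimeTo _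
coprime-^ˡ (suc a) c = coprime-*ˡ c (coprime-^ˡ a c)

prime∧∤⇒coprime : ∀ {p d} → Prime p → ¬ p ∣ d → Coprime p d
prime∧∤⇒coprime p-prime p∤d {i} (i∣p , i∣d) with prime⇒irreducible p-prime i∣p
... | inj₁ i≡1  = i≡1
... | inj₂ refl = contradiction i∣d p∤d

-- Binomial coefficients

-- Sealed, as unfolding _C_ makes the type checker normalise factorials.
abstract
  binom : ℕ → ℕ → ℤ
  binom n k = + (n C k)

  binom-C : ∀ n k → binom n k ≡ + (n C k)
  binom-C n k = refl

  pascal : ∀ n k → binom (suc n) (suc k) ≡ binom n k + binom n (suc k)
  pascal n k = cong +_ (sym (nCk+nC[k+1]≡[n+1]C[k+1] n k))

  binom-0 : ∀ n → binom n 0 ≡ 1ℤ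
  binom-0 zero    = refl
  binom-0 (suc n) = refl

  binom-1 : ∀ n → binom n 1 ≡ + n
  binom-1 n = cong +_ (nC1≡n n)

  binom-diag : ∀ n → binom n n ≡ 1ℤ
  binom-diag n = cong +_ (nCn≡1 n)

  binom-above : ∀ n → binom n (suc n) ≡ 0ℤ
  binom-above n = cong +_ (k>n⇒nCk≡0 (ℕ.n<1+n n))

  binom-sym : ∀ n k → binom (n ℕ.+ k) n ≡ binom (n ℕ.+ k) k
  binom-sym n k = cong +_ (trans (nCk≡nC[n∸k] (ℕ.m≤m+n n k)) (cong ((n ℕ.+ k) C_) (ℕ.m+n∸m≡n n k)))

  binom-zero : ∀ k → binom 0 (suc k) ≡ 0ℤ
  binom-zero k = refl

-- Induction by Pascal's rule also covers `k > n`, which the factorial formula would exclude.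
binom-absorb : ∀ n k → + suc k * binom (suc n) (suc k) ≡ + suc n * binom n k
binom-absorb n       zero    = trans (ℤ.*-identityˡ _)
  (trans (binom-1 (suc n)) (sym (trans (cong (_*_ (+ suc n)) (binom-0 n)) (ℤ.*-identityʳ (+ suc n)))))
binom-absorb zero    (suc k) = trans
  (cong (_*_ (+ suc (suc k))) (trans (pascal 0 (suc k)) (cong₂ _+_ (binom-zero k) (binom-zero (suc k)))))
  (trans (ℤ.*-zeroʳ (+ suc (suc k))) (sym (cong (_*_ 1ℤ) (binom-zero k))))
binom-absorb (suc n) (suc k) =
  ≡-combine (+ suc (suc k)) (pascal (suc n) (suc k))
  (≡-combine 1ℤ (binom-absorb n k)
  (≡-combine 1ℤ (binom-absorb n (suc k))
  (≡-combine (- (1ℤ + + n)) (pascal n k)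
    (ring (+ n) (+ k) (binom n k) (binom n (suc k)) (binom (suc n) (suc k))
      (binom (suc n) (suc (suc k))) (binom (suc (suc n)) (suc (suc k)))))))
  where
  ring : ∀ n k a b c d e → (1ℤ + (1ℤ + k)) * e ≡
    (1ℤ + (1ℤ + n)) * c + (1ℤ + (1ℤ + k)) * (e - (c + d))
      + 1ℤ * ((1ℤ + k) * c - (1ℤ + n) * a)
      + 1ℤ * ((1ℤ + (1ℤ + k)) * d - (1ℤ + n) * b)
      + (- (1ℤ + n)) * (c - (a + b))
  ring = solve-∀

binom-suc : ∀ n k → + suc k * binom n (suc k) ≡ (+ n - + k) * binom n k
binom-suc n k = ≡-combine 1ℤ
  (trans (cong (_*_ (+ suc k)) (sym (pascal n k))) (binom-absorb n k))
  (ring (+ n) (+ k) (binom n k) (binom n (suc k)))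
  where
  ring : ∀ n k a b → (1ℤ + k) * b ≡
    (n - k) * a + 1ℤ * ((1ℤ + k) * (a + b) - (1ℤ + n) * a)
  ring = solve-∀

-- The offset `i` serves the induction: Pascal's rule in the first factor splits the sum into those
-- for `n` with offsets `i` and `i + 1`.
vandermonde : ∀ n m i → (∑ℤ[ k < suc n ] (binom n k * binom m (i ℕ.+ k))) ≡ binom (n ℕ.+ m) (n ℕ.+ i)
vandermonde zero    m i = trans (ℤ.+-identityʳ _) (trans (cong (_* binom m (i ℕ.+ 0)) (binom-0 0))
  (trans (ℤ.*-identityˡ _) (cong (binom m) (ℕ.+-identityʳ i))))
vandermonde (suc n) m i = begin
  binom (suc n) 0 * binom m (i ℕ.+ 0)
    + (∑ℤ[ k < suc n ] (binom (suc n) (suc k) * binom m (i ℕ.+ suc k)))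
    ≡⟨ cong₂ _+_ (cong (_* binom m (i ℕ.+ 0)) (trans (binom-0 (suc n)) (sym (binom-0 n))))
         (trans (∑-cong (suc n) λ k _ → trans (cong (_* binom m (i ℕ.+ suc k)) (pascal n k))
                  (ℤ.*-distribʳ-+ (binom m (i ℕ.+ suc k)) (binom n k) (binom n (suc k))))
                (∑-+ (suc n) (λ k → binom n k * binom m (i ℕ.+ suc k))
                             (λ k → binom n (suc k) * binom m (i ℕ.+ suc k)))) ⟩
  binom n 0 * binom m (i ℕ.+ 0) + (A + B)
    ≡⟨ ring (binom n 0 * binom m (i ℕ.+ 0)) A B ⟩
  (binom n 0 * binom m (i ℕ.+ 0) + B) + A
    ≡⟨ cong₂ _+_ rows-0 rows-1 ⟩
  binom (n ℕ.+ m) (n ℕ.+ i) + binom (n ℕ.+ m) (suc (n ℕ.+ i))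
    ≡⟨ pascal (n ℕ.+ m) (n ℕ.+ i) ⟨
  binom (suc n ℕ.+ m) (suc n ℕ.+ i) ∎
  where
  open ≡-Reasoning
  A B : ℤ
  A = ∑ℤ[ k < suc n ] (binom n k * binom m (i ℕ.+ suc k))
  B = ∑ℤ[ k < suc n ] (binom n (suc k) * binom m (i ℕ.+ suc k))
  ring : ∀ x y z → x + (y + z) ≡ (x + z) + y
  ring = solve-∀
  rows-1 : A ≡ binom (n ℕ.+ m) (suc (n ℕ.+ i))
  rows-1 = trans (∑-cong (suc n) λ k _ → cong (λ t → binom n k * binom m t) (ℕ.+-suc i k))
    (trans (vandermonde n m (suc i)) (cong (binom (n ℕ.+ m)) (ℕ.+-suc n i)))
  rows-0 : binom n 0 * binom m (i ℕ.+ 0) + B ≡ binom (n ℕ.+ m) (n ℕ.+ i)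
  rows-0 = begin
    ∑ℤ (suc (suc n)) f            ≡⟨ ∑-last (suc n) f ⟩
    ∑ℤ (suc n) f + f (suc n)      ≡⟨ cong (_+_ (∑ℤ (suc n) f)) (cong (_* binom m (i ℕ.+ suc n)) (binom-above n)) ⟩
    ∑ℤ (suc n) f + 0ℤ             ≡⟨ ℤ.+-identityʳ _ ⟩
    ∑ℤ (suc n) f                  ≡⟨ vandermonde n m i ⟩
    binom (n ℕ.+ m) (n ℕ.+ i)     ∎
    where
    f : ℕ → ℤ
    f k = binom n k * binom m (i ℕ.+ k)

central : ℕ → ℤ
central n = binom (n ℕ.+ n) n

middle-≡ : ∀ n → + suc n * binom (n ℕ.+ suc n) (suc n) ≡ + suc n * binom (n ℕ.+ suc n) n
middle-≡ n = trans (binom-suc (n ℕ.+ suc n) n) (cong (_* binom (n ℕ.+ suc n) n) (ring (+ n)))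
  where
  ring : ∀ n → n + (1ℤ + n) - n ≡ 1ℤ + n
  ring = solve-∀

central-suc : ∀ n → + suc n * central (suc n) ≡ + 2 * (+ 2 * + n + 1ℤ) * central n
central-suc n =
  ≡-combine (+ suc n) (pascal (n ℕ.+ suc n) n)
  (≡-combine (- 1ℤ) (middle-≡ n)
  (≡-combine (+ 2) (trans (cong (λ t → + suc n * binom t (suc n)) (ℕ.+-suc n n)) (binom-absorb (n ℕ.+ n) n))
    (ring (+ n) (central n) (central (suc n)) (binom (n ℕ.+ suc n) n) (binom (n ℕ.+ suc n) (suc n)))))
  where
  ring : ∀ n c c′ U V → (1ℤ + n) * c′ ≡ + 2 * (+ 2 * n + 1ℤ) * c
    + (1ℤ + n) * (c′ - (U + V)) + (- 1ℤ) * ((1ℤ + n) * V - (1ℤ + n) * U)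
    + + 2 * ((1ℤ + n) * V - (1ℤ + (n + n)) * c)
  ring = solve-∀

-- The cubic sum as a sum of squares

squareSum : ℕ → ℤ
squareSum n = ∑ℤ[ k < suc n ] (binom (n ℕ.+ k) k * binom (n ℕ.+ k) k)

-- The last summand is the Gosper certificate of the recursion squareSum-rec.
squareSum-partial : ∀ n K →
  + 8 * (+ 2 * + suc n + 1ℤ) * (∑ℤ[ k < suc K ] (binom (suc n ℕ.+ k) k * binom (suc n ℕ.+ k) k))
  ≡ + 4 * + suc n * (∑ℤ[ k < suc K ] (binom (n ℕ.+ k) k * binom (n ℕ.+ k) k))
    + + 4 * (+ 3 * + suc n + + 2 * + K + + 2) * (binom (suc n ℕ.+ K) K * binom (suc n ℕ.+ K) K)
squareSum-partial n zero
  rewrite binom-0 (suc n ℕ.+ 0) | binom-0 (n ℕ.+ 0) = ring (+ n)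
  where
  ring : ∀ n → + 8 * (+ 2 * (1ℤ + n) + 1ℤ) * 1ℤ
    ≡ + 4 * (1ℤ + n) * 1ℤ + + 4 * (+ 3 * (1ℤ + n) + + 2 * 0ℤ + + 2) * 1ℤ
  ring = solve-∀
squareSum-partial n (suc K)
  rewrite ∑-last (suc K) (λ k → binom (suc n ℕ.+ k) k * binom (suc n ℕ.+ k) k)
        | ∑-last (suc K) (λ k → binom (n ℕ.+ k) k * binom (n ℕ.+ k) k)
        | pascal (n ℕ.+ suc K) K =
  ≡-combine 1ℤ (trans (squareSum-partial n K)
    (cong (λ y → + 4 * + suc n * T + + 4 * (+ 3 * + suc n + + 2 * + K + + 2) * (y * y))
      (cong (λ t → binom t K) (sym (ℕ.+-suc n K)))))
  (≡-combine (- (+ 8 * X + + 16 * Y)) (binom-suc (n ℕ.+ suc K) K) (ring (+ n) (+ K) S T X Y))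
  where
  S T X Y : ℤ
  S = ∑ℤ[ k < suc K ] (binom (suc n ℕ.+ k) k * binom (suc n ℕ.+ k) k)
  T = ∑ℤ[ k < suc K ] (binom (n ℕ.+ k) k * binom (n ℕ.+ k) k)
  X = binom (n ℕ.+ suc K) (suc K)
  Y = binom (n ℕ.+ suc K) K
  ring : ∀ n K S T X Y →
    + 8 * (+ 2 * (1ℤ + n) + 1ℤ) * (S + (Y + X) * (Y + X)) ≡
    + 4 * (1ℤ + n) * (T + X * X) + + 4 * (+ 3 * (1ℤ + n) + + 2 * (1ℤ + K) + + 2) * ((Y + X) * (Y + X))
    + 1ℤ * (+ 8 * (+ 2 * (1ℤ + n) + 1ℤ) * S -
        (+ 4 * (1ℤ + n) * T + + 4 * (+ 3 * (1ℤ + n) + + 2 * K + + 2) * (Y * Y)))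
    + (- (+ 8 * X + + 16 * Y)) * ((1ℤ + K) * X - (n + (1ℤ + K) - K) * Y)
  ring = solve-∀

-- The origin of 21: with ν = n + 1 and `K = ν` the certificate is (20ν + 8) c² for c = C(2ν,ν), and
-- the extra last summand of the inner sum is (c/2)², which adds 4ν (c/2)² = ν c².
squareSum-rec : ∀ n → + 8 * (+ 2 * + suc n + 1ℤ) * squareSum (suc n) ≡
  + 4 * + suc n * squareSum n + (+ 21 * + suc n + + 8) * (central (suc n) * central (suc n))
squareSum-rec n =
  ≡-combine 1ℤ (squareSum-partial n (suc n))
  (≡-combine (+ 4 * + suc n) (∑-last (suc n) λ k → binom (n ℕ.+ k) k * binom (n ℕ.+ k) k)
  (≡-combine (- (+ suc n * (central (suc n) + (U + V)))) (pascal (n ℕ.+ suc n) n)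
  (≡-combine (U + + 3 * V) (middle-≡ n)
    (ring (+ n) (squareSum (suc n)) (squareSum n)
      (∑ℤ[ k < suc (suc n) ] (binom (n ℕ.+ k) k * binom (n ℕ.+ k) k)) (central (suc n)) U V))))
  where
  U V : ℤ
  U = binom (n ℕ.+ suc n) n
  V = binom (n ℕ.+ suc n) (suc n)
  ring : ∀ n s t t′ c U V →
    + 8 * (+ 2 * (1ℤ + n) + 1ℤ) * s ≡
    + 4 * (1ℤ + n) * t + (+ 21 * (1ℤ + n) + + 8) * (c * c)
    + 1ℤ * (+ 8 * (+ 2 * (1ℤ + n) + 1ℤ) * s -
        (+ 4 * (1ℤ + n) * t′ + + 4 * (+ 3 * (1ℤ + n) + + 2 * (1ℤ + n) + + 2) * (c * c)))
    + + 4 * (1ℤ + n) * (t′ - (t + V * V))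
    + (- ((1ℤ + n) * (c + (U + V)))) * (c - (U + V))
    + (U + + 3 * V) * ((1ℤ + n) * V - (1ℤ + n) * U)
  ring = solve-∀

cubicTerm : ℕ → ℤ
cubicTerm k = (+ 21 * + k + + 8) * (central k * central k * central k)

-- Multiplied by `central (suc n)`, `squareSum-rec` telescopes, because 4 (n+1) C(2n+2,n+1) = 8
-- (2n+1) C(2n,n).
cubicSum : ∀ n → ∑ℤ (suc n) cubicTerm ≡ + 8 * (+ 2 * + n + 1ℤ) * central n * squareSum n
cubicSum zero rewrite binom-0 0 = refl
cubicSum (suc n) = trans (∑-last (suc n) cubicTerm)
  (≡-combine 1ℤ (cubicSum n)
  (≡-combine (- (+ 4 * squareSum n)) (central-suc n)
  (≡-combine (- central (suc n)) (squareSum-rec n)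
    (ring (+ n) (∑ℤ (suc n) cubicTerm) (central n) (central (suc n)) (squareSum n) (squareSum (suc n))))))
  where
  ring : ∀ n S c c′ b b′ → S + (+ 21 * (1ℤ + n) + + 8) * (c′ * c′ * c′) ≡
    + 8 * (+ 2 * (1ℤ + n) + 1ℤ) * c′ * b′
    + 1ℤ * (S - + 8 * (+ 2 * n + 1ℤ) * c * b)
    + (- (+ 4 * b)) * ((1ℤ + n) * c′ - + 2 * (+ 2 * n + 1ℤ) * c)
    + (- c′) * (+ 8 * (+ 2 * (1ℤ + n) + 1ℤ) * b′ - (+ 4 * (1ℤ + n) * b + (+ 21 * (1ℤ + n) + + 8) * (c′ * c′)))
  ring = solve-∀

-- Summation by parts and truncated hypergeometric sums

sign-square : ∀ n → -1ℤ ^ n * -1ℤ ^ n ≡ 1ℤ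
sign-square zero    = refl
sign-square (suc n) = trans (ring (-1ℤ ^ n)) (sign-square n)
  where
  ring : ∀ s → - 1ℤ * s * (- 1ℤ * s) ≡ s * s
  ring = solve-∀


-- Summation by parts: by Pascal's rule (-1)^j C(M+1,j) is the backward difference of (-1)^j C(M,j).
alternating-pascal : ∀ M n (g : ℕ → ℤ) →
  (∑ℤ[ j < suc n ] (-1ℤ ^ j * binom (suc M) j * g j)) ≡
  -1ℤ ^ n * binom M n * g n - (∑ℤ[ j < n ] (-1ℤ ^ j * binom M j * (g (suc j) - g j)))
alternating-pascal M zero    g rewrite binom-0 (suc M) | binom-0 M = ring (g 0)
  where
  ring : ∀ x → 1ℤ * 1ℤ * x + 0ℤ ≡ 1ℤ * 1ℤ * x - 0ℤ
  ring = solve-∀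
alternating-pascal M (suc n) g
  rewrite ∑-last (suc n) (λ j → -1ℤ ^ j * binom (suc M) j * g j)
        | ∑-last n (λ j → -1ℤ ^ j * binom M j * (g (suc j) - g j))
        | alternating-pascal M n g | pascal M n =
  ring (-1ℤ ^ n) (binom M n) (binom M (suc n)) (g n) (g (suc n)) _
  where
  ring : ∀ s a b x y T →
    s * a * x - T + - 1ℤ * s * (a + b) * y ≡ - 1ℤ * s * b * y - (T + s * a * (y - x))
  ring = solve-∀

-- One summation by parts lowers both the row `a + b + 1` and the lower index `i + b`, as C(n+j,i+b)
-- is a difference in j; its boundary term is the last summand on the right. Only `b` descends,
-- hence the separate `a`, `n` and `i`.
alternating-product : ∀ b a n i →
  -1ℤ ^ b * (∑ℤ[ j < suc b ] (-1ℤ ^ j * binom (suc (a ℕ.+ b)) j * binom (n ℕ.+ j) (i ℕ.+ b))) ≡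
  (∑ℤ[ k < suc b ] (binom (a ℕ.+ k) k * binom (n ℕ.+ k) (i ℕ.+ k)))
alternating-product zero    a n i
  rewrite binom-0 (suc (a ℕ.+ 0)) | binom-0 (a ℕ.+ 0) = ring (binom (n ℕ.+ 0) (i ℕ.+ 0))
  where
  ring : ∀ x → 1ℤ * (1ℤ * 1ℤ * x + 0ℤ) ≡ 1ℤ * x + 0ℤ
  ring = solve-∀
alternating-product (suc b) a n i = begin
  -1ℤ ^ suc b * (∑ℤ[ j < suc (suc b) ] (-1ℤ ^ j * binom (suc (a ℕ.+ suc b)) j * g j))
    ≡⟨ cong (_*_ (-1ℤ ^ suc b)) (alternating-pascal (a ℕ.+ suc b) (suc b) g) ⟩
  -1ℤ ^ suc b * (-1ℤ ^ suc b * binom (a ℕ.+ suc b) (suc b) * g (suc b) -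
    (∑ℤ[ j < suc b ] (-1ℤ ^ j * binom (a ℕ.+ suc b) j * (g (suc j) - g j))))
    ≡⟨ cong (λ t → -1ℤ ^ suc b * (-1ℤ ^ suc b * binom (a ℕ.+ suc b) (suc b) * g (suc b) - t))
         (∑-cong (suc b) λ j _ → cong₂ (λ M d → -1ℤ ^ j * binom M j * d) (ℕ.+-suc a b) (difference j)) ⟩
  -1ℤ ^ suc b * (-1ℤ ^ suc b * binom (a ℕ.+ suc b) (suc b) * g (suc b) - T)
    ≡⟨ ring (-1ℤ ^ b) T (binom (a ℕ.+ suc b) (suc b)) (g (suc b)) ⟩
  -1ℤ ^ b * T + (-1ℤ ^ b * -1ℤ ^ b) * (binom (a ℕ.+ suc b) (suc b) * g (suc b))
    ≡⟨ cong₂ _+_ (alternating-product b a n i)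
         (trans (cong (_* (binom (a ℕ.+ suc b) (suc b) * g (suc b))) (sign-square b)) (ℤ.*-identityˡ _)) ⟩
  (∑ℤ[ k < suc b ] h k) + h (suc b)
    ≡⟨ ∑-last (suc b) h ⟨
  (∑ℤ[ k < suc (suc b) ] h k) ∎
  where
  open ≡-Reasoning
  g h : ℕ → ℤ
  g j = binom (n ℕ.+ j) (i ℕ.+ suc b)
  h k = binom (a ℕ.+ k) k * binom (n ℕ.+ k) (i ℕ.+ k)
  T : ℤ
  T = ∑ℤ[ j < suc b ] (-1ℤ ^ j * binom (suc (a ℕ.+ b)) j * binom (n ℕ.+ j) (i ℕ.+ b))
  difference : ∀ j → g (suc j) - g j ≡ binom (n ℕ.+ j) (i ℕ.+ b)
  difference j rewrite ℕ.+-suc n j | ℕ.+-suc i b | pascal (n ℕ.+ j) (i ℕ.+ b) =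
    ring′ (binom (n ℕ.+ j) (i ℕ.+ b)) (binom (n ℕ.+ j) (suc (i ℕ.+ b)))
    where
    ring′ : ∀ x y → x + y - y ≡ x
    ring′ = solve-∀
  ring : ∀ s T x y → - 1ℤ * s * (- 1ℤ * s * x * y - T) ≡ s * T + s * s * (x * y)
  ring = solve-∀

-- The series 2F1(-N, q+1; 1; 1) cut off after j = n.
truncated : ℕ → ℕ → ℕ → ℤ
truncated N n q = ∑ℤ[ j < suc n ] (-1ℤ ^ j * binom N j * binom (q ℕ.+ j) j)

squareSum-truncated : ∀ n → squareSum n ≡ -1ℤ ^ n * truncated (suc (n ℕ.+ n)) n n
squareSum-truncated n = trans (sym (alternating-product n n n 0))
  (cong (_*_ (-1ℤ ^ n)) (∑-cong (suc n) λ j _ →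
    cong (_*_ (-1ℤ ^ j * binom (suc (n ℕ.+ n)) j)) (binom-sym n j)))

-- A contiguous relation in `q`. The complete series satisfies it with right side 0, and truncation
-- leaves the boundary term.
truncated-partial : ∀ N q n →
  + suc q * truncated N n q + (+ N - + suc q) * truncated N n (suc q) ≡
  -1ℤ ^ n * + suc n * binom N (suc n) * binom (suc q ℕ.+ n) n
truncated-partial N q zero
  rewrite binom-0 N | binom-0 (q ℕ.+ 0) | binom-0 (suc q ℕ.+ 0) | binom-1 N = ring (+ N) (+ q)
  where
  ring : ∀ N q → (1ℤ + q) * (1ℤ * 1ℤ * 1ℤ + 0ℤ) + (N - (1ℤ + q)) * (1ℤ * 1ℤ * 1ℤ + 0ℤ)
    ≡ 1ℤ * 1ℤ * N * 1ℤ
  ring = solve-∀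
truncated-partial N q (suc n)
  rewrite ∑-last (suc n) (λ j → -1ℤ ^ j * binom N j * binom (q ℕ.+ j) j)
        | ∑-last (suc n) (λ j → -1ℤ ^ j * binom N j * binom (suc q ℕ.+ j) j)
        | pascal (q ℕ.+ suc n) n =
  ≡-combine 1ℤ (trans (truncated-partial N q n)
    (cong (λ t → -1ℤ ^ n * + suc n * binom N (suc n) * binom t n) (sym (ℕ.+-suc q n))))
  (≡-combine (- (-1ℤ ^ n * binom N (suc n))) (binom-suc (q ℕ.+ suc n) n)
  (≡-combine (-1ℤ ^ n * (X + Y)) (binom-suc N (suc n))
    (ring (+ N) (+ q) (+ n) (-1ℤ ^ n) (truncated N n q) (truncated N n (suc q))
      (binom N (suc n)) (binom N (suc (suc n))) X Y)))
  where
  X Y : ℤ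
  X = binom (q ℕ.+ suc n) (suc n)
  Y = binom (q ℕ.+ suc n) n
  ring : ∀ N q n s T T′ D D′ X Y →
    (1ℤ + q) * (T + - 1ℤ * s * D * X) + (N - (1ℤ + q)) * (T′ + - 1ℤ * s * D * (Y + X)) ≡
    - 1ℤ * s * (1ℤ + (1ℤ + n)) * D′ * (Y + X)
    + 1ℤ * ((1ℤ + q) * T + (N - (1ℤ + q)) * T′ - s * (1ℤ + n) * D * Y)
    + (- (s * D)) * ((1ℤ + n) * X - (q + (1ℤ + n) - n) * Y)
    + s * (X + Y) * ((1ℤ + (1ℤ + n)) * D′ - (N - (1ℤ + n)) * D)
  ring = solve-∀

-- This is A(n) for `N = p - 1` and `n + q = N`. At n = q = m the factor `binom N n` is the C(2m,m)
-- in front of b(m).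
normalised : ℕ → ℕ → ℕ → ℤ
normalised N n q = -1ℤ ^ n * binom N n * truncated (suc N) n q

-- The increments of the normalised sum carry the factor N², which is what makes
-- it accessible modulo p³ when N = p.
normalised-suc : ∀ n q → let N = n ℕ.+ suc q ; ν = + suc n in
  ν * ν * ν * (normalised N (suc n) q - normalised N n (suc q)) ≡
  + suc N * + suc N * (binom N n * binom N n * binom N n) * (+ suc N - + 2 * ν)
normalised-suc n q =
  ≡-combine (- (s * ν * ν * F₀) + s * s * ν * D * (ν * c′ + Q * c)) (binom-suc N n)
  (≡-combine (s * s * c * c * (Q * Q - ν * ν)) (binom-absorb N n)
  (≡-combine (- (s * ν * ν * c)) partial
  (≡-combine (+ suc N * + suc N * (c * c * c) * (+ suc N - + 2 * ν)) (sign-square n)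
  (≡-combine (- (s * ν * ν * ν * c′)) last
    (ring (+ n) (+ q) s c c′ D F₀ F F′)))))
  where
  N = n ℕ.+ suc q
  ν = + suc n
  Q = + suc q
  s = -1ℤ ^ n
  c = binom N n
  c′ = binom N (suc n)
  D = binom (suc N) (suc n)
  F₀ = truncated (suc N) n q
  F = truncated (suc N) n (suc q)
  F′ = truncated (suc N) (suc n) q
  partial : Q * F₀ + (+ suc N - Q) * F ≡ s * ν * D * c
  partial = trans (truncated-partial (suc N) q n)
    (cong (λ t → s * ν * D * binom t n) (ℕ.+-comm (suc q) n))
  last : F′ ≡ F₀ + -1ℤ * s * D * c′
  last = trans (∑-last (suc n) λ j → -1ℤ ^ j * binom (suc N) j * binom (q ℕ.+ j) j)
    (cong (λ t → F₀ + -1ℤ * s * D * binom t (suc n)) (trans (ℕ.+-suc q n) (ℕ.+-comm (suc q) n)))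
  ring : ∀ n q s c c′ D F₀ F F′ →
    let ν = 1ℤ + n ; Q = 1ℤ + q ; N = 1ℤ + (n + Q) in
    ν * ν * ν * (- 1ℤ * s * c′ * F′ - s * c * F) ≡
    N * N * (c * c * c) * (N - + 2 * ν)
    + (- (s * ν * ν * F₀) + s * s * ν * D * (ν * c′ + Q * c)) * (ν * c′ - (n + Q - n) * c)
    + s * s * c * c * (Q * Q - ν * ν) * (ν * D - N * c)
    + (- (s * ν * ν * c)) * (Q * F₀ + (N - Q) * F - s * ν * D * c)
    + N * N * (c * c * c) * (N - + 2 * ν) * (s * s - 1ℤ)
    + (- (s * ν * ν * ν * c′)) * (F′ - (F₀ + - 1ℤ * s * D * c′))
  ring = solve-∀

-- Residues modulo a prime

Exp-^ : ∀ x n → x Exp.^ n ≡ x ^ n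
Exp-^ x zero    = refl
Exp-^ x (suc n) = cong (x *_) (Exp-^ x n)

Mult-* : ∀ n x → n Mult.× x ≡ + n * x
Mult-* zero    x = refl
Mult-* (suc n) x = trans (cong (_+_ x) (Mult-* n x)) (ring x (+ n))
  where
  ring : ∀ x n → x + n * x ≡ (1ℤ + n) * x
  ring = solve-∀

binomial-theorem : ∀ n x y → (∑ℤ[ k < suc n ] (binom n k * (x ^ k * y ^ (n ∸ k)))) ≡ (x + y) ^ n
binomial-theorem n x y = begin
  (∑ℤ[ k < suc n ] (binom n k * (x ^ k * y ^ (n ∸ k))))
    ≡⟨ ∑-cong (suc n) (λ k _ → cong₂ _*_ (binom-C n k)
         (sym (cong₂ _*_ (Exp-^ x k) (Exp-^ y (n ∸ k))))) ⟩
  (∑ℤ[ k < suc n ] (+ (n C k) * (x Exp.^ k * y Exp.^ (n ∸ k))))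
    ≡⟨ ∑-cong (suc n) (λ k _ → sym (Mult-* (n C k) (x Exp.^ k * y Exp.^ (n ∸ k)))) ⟩
  Binomial.binomialExpansion x y n
    ≡⟨ Binomial.theorem n x y ⟨
  (x + y) Exp.^ n
    ≡⟨ Exp-^ (x + y) n ⟩
  (x + y) ^ n ∎
  where
  open ≡-Reasoning
  open import Data.Nat.Combinatorics using (_C_)

^-distrib-* : ∀ x y n → (x * y) ^ n ≡ x ^ n * y ^ n
^-distrib-* x y zero    = refl
^-distrib-* x y (suc n) = trans (cong (_*_ (x * y)) (^-distrib-* x y n)) (ring x y (x ^ n) (y ^ n))
  where
  ring : ∀ x y u v → x * y * (u * v) ≡ x * u * (y * v)
  ring = solve-∀

coprime-^ : ∀ {p d} a → Coprime p d → Coprime ∣ (+ p) ^ a ∣ d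
coprime-^ zero        c = Coprimality.1-coprimeTo _
coprime-^ {p} (suc a) c = subst (λ n → Coprime n _) (sym (ℤ.abs-* (+ p) ((+ p) ^ a)))
  (coprime-*ˡ c (coprime-^ a c))

module _ {p : ℕ} (p-prime : Prime p) where

  ≈-cancel : ∀ a {x y} d → ¬ p ∣ ∣ d ∣ → d * x ≈ d * y [ (+ p) ^ a ] → x ≈ y [ (+ p) ^ a ]
  ≈-cancel a d p∤d = ≈-cancelˡ d (coprime-^ a (prime∧∤⇒coprime p-prime p∤d))

  ∤-* : ∀ {x y} → ¬ p ∣ ∣ x ∣ → ¬ p ∣ ∣ y ∣ → ¬ p ∣ ∣ x * y ∣
  ∤-* {x} {y} p∤x p∤y p∣xy = [ p∤x , p∤y ]′
    (euclidsLemma ∣ x ∣ ∣ y ∣ p-prime (subst (p ∣_) (ℤ.abs-* x y) p∣xy))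

modulus≈0 : ∀ {M} → M ≈ 0ℤ [ M ]
modulus≈0 {M} = 1ℤ , ring M
  where
  ring : ∀ M → M ≡ 0ℤ + 1ℤ * M
  ring = solve-∀

p≈0 : ∀ {p} → + p ≈ 0ℤ [ (+ p) ^ 1 ]
p≈0 {p} = subst (_≈ 0ℤ [ (+ p) ^ 1 ]) (ℤ.*-identityʳ (+ p)) modulus≈0

module _ {N : ℕ} (p-prime : Prime (suc N)) where

  private
    p : ℕ
    p = suc N
    P : ℤ
    P = + p

  below-∤ : ∀ {i} → i < N → ¬ p ∣ ∣ + suc i ∣
  below-∤ i<N = >⇒∤ (s≤s i<N)

  -- Each step multiplies by (N - n)/(n + 1), which is -1 modulo `p` because N + 1 = p.
  binom-≈ : ∀ n → n ≤ N → binom N n ≈ -1ℤ ^ n [ P ^ 1 ]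
  binom-≈ zero    n≤N = ≈-reflexive (binom-0 N)
  binom-≈ (suc n) n<N = ≈-cancel p-prime 1 (+ suc n) (below-∤ n<N)
    (≈-trans (≈-reflexive (binom-suc N n))
      (≈-combine (+ N - + n) (-1ℤ ^ n) (binom-≈ n (ℕ.<⇒≤ n<N)) (ring (+ N) (+ n) (binom N n) (-1ℤ ^ n))))
    where
    ring : ∀ N n c s → (N - n) * c ≡ (1ℤ + n) * (- 1ℤ * s) + (N - n) * (c - s) + s * ((1ℤ + N) * 1ℤ)
    ring = solve-∀

  binom-shift-≈ : ∀ n → n ≤ N → binom (p ℕ.+ n) n ≈ 1ℤ [ P ^ 1 ]
  binom-shift-≈ zero    n≤N = ≈-reflexive (binom-0 (p ℕ.+ 0))
  binom-shift-≈ (suc n) n<N = ≈-cancel p-prime 1 (+ suc n) (below-∤ n<N)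
    (≈-trans (≈-reflexive (trans (cong (λ t → + suc n * binom t (suc n)) (ℕ.+-suc p n)) (binom-absorb (p ℕ.+ n) n)))
      (≈-combine (1ℤ + (P + + n)) 1ℤ (binom-shift-≈ n (ℕ.<⇒≤ n<N)) (ring P (+ n) (binom (p ℕ.+ n) n))))
    where
    ring : ∀ P n c → (1ℤ + (P + n)) * c ≡ (1ℤ + n) * 1ℤ + (1ℤ + (P + n)) * (c - 1ℤ) + 1ℤ * (P * 1ℤ)
    ring = solve-∀

  binom-p : ∀ k → + suc k * binom p (suc k) ≡ P * binom N k
  binom-p k = binom-absorb N k

  binom-p-≈0 : ∀ k → k < N → binom p (suc k) ≈ 0ℤ [ P ^ 1 ]
  binom-p-≈0 k k<N = ≈-cancel p-prime 1 (+ suc k) (below-∤ k<N)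
    (≈-trans (≈-reflexive (binom-p k))
      (≈-combine 0ℤ (binom N k) (≈-refl {x = 0ℤ}) (ring P (+ k) (binom N k))))
    where
    ring : ∀ P k c → P * c ≡ (1ℤ + k) * 0ℤ + 0ℤ * (0ℤ - 0ℤ) + c * (P * 1ℤ)
    ring = solve-∀

  -- Induction on `a`: the inner coefficients in the expansion of (1 + a)^p vanish modulo `p`.
  fermat : ∀ a → (+ a) ^ p ≈ + a [ P ^ 1 ]
  fermat zero    = ≈-refl
  fermat (suc a) = begin
    (1ℤ + + a) ^ p                  ≡⟨ binomial-theorem p 1ℤ (+ a) ⟨
    ∑ℤ (suc p) f                    ≡⟨ ∑-last p f ⟩
    ∑ℤ p f + f p                    ≡⟨ cong (λ t → f 0 + ∑ℤ N (f ∘ suc) + t) (f-p) ⟩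
    f 0 + ∑ℤ N (f ∘ suc) + 1ℤ       ≈⟨ +-≈ (+-≈ f-0 middle) (≈-refl {x = 1ℤ}) ⟩
    + a + 0ℤ + 1ℤ                   ≡⟨ ring (+ a) ⟩
    1ℤ + + a ∎
    where
    open import Relation.Binary.Reasoning.Setoid (≈-setoid (P ^ 1))
    f : ℕ → ℤ
    f k = binom p k * (1ℤ ^ k * (+ a) ^ (p ∸ k))
    ring : ∀ a → a + 0ℤ + 1ℤ ≡ 1ℤ + a
    ring = solve-∀
    f-0 : f 0 ≈ + a [ P ^ 1 ]
    f-0 = ≈-trans (≈-reflexive (trans (cong (_* (1ℤ * (+ a) ^ p)) (binom-0 p))
      (trans (ℤ.*-identityˡ _) (ℤ.*-identityˡ _)))) (fermat a)
    f-p : f p ≡ 1ℤ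
    f-p rewrite ℕ.n∸n≡0 N | binom-diag p | ℤ.^-zeroˡ p = refl
    middle : ∑ℤ N (f ∘ suc) ≈ 0ℤ [ P ^ 1 ]
    middle = ≈-trans (∑-≈ N {f ∘ suc} {λ k → 0ℤ * r k} λ k k<N → *-≈ (binom-p-≈0 k k<N) (≈-refl {x = r k}))
      (≈-reflexive (trans (∑-*ˡ N 0ℤ r) (ℤ.*-zeroˡ (∑ℤ N r))))
      where
      r : ℕ → ℤ
      r k = 1ℤ ^ suc k * (+ a) ^ (N ∸ k)

∑-even-odd : ∀ n (g : ℕ → ℤ) →
  ∑ℤ (n ℕ.+ n) g ≡ (∑ℤ[ i < n ] g (i ℕ.+ i)) + (∑ℤ[ i < n ] g (suc (i ℕ.+ i)))
∑-even-odd zero    g = refl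
∑-even-odd (suc n) g rewrite ℕ.+-suc n n
  | ∑-last (suc (n ℕ.+ n)) g | ∑-last (n ℕ.+ n) g
  | ∑-last n (λ i → g (i ℕ.+ i)) | ∑-last n (λ i → g (suc (i ℕ.+ i)))
  | ∑-even-odd n g = ring (∑ℤ[ i < n ] g (i ℕ.+ i)) (∑ℤ[ i < n ] g (suc (i ℕ.+ i))) (g (n ℕ.+ n)) (g (suc (n ℕ.+ n)))
  where
  ring : ∀ a b x y → a + b + x + y ≡ (a + x) + (b + y)
  ring = solve-∀

∑-split : ∀ m n (g : ℕ → ℤ) → ∑ℤ (m ℕ.+ n) g ≡ ∑ℤ m g + (∑ℤ[ i < n ] g (m ℕ.+ i))
∑-split zero    n g = sym (ℤ.+-identityˡ _)
∑-split (suc m) n g = trans (cong (_+_ (g 0)) (∑-split m n (g ∘ suc))) (sym (ℤ.+-assoc (g 0) _ _))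

-- Moving the window by one place loses `g a` and gains `g (p + a)`, which are congruent.
∑-shift : ∀ {M} p (g : ℕ → ℤ) → (∀ i → g (p ℕ.+ i) ≈ g i [ M ]) →
  ∀ a → (∑ℤ[ i < p ] g (a ℕ.+ i)) ≈ ∑ℤ p g [ M ]
∑-shift p g periodic zero    = ≈-refl
∑-shift {M} p g periodic (suc a) = ≈-trans
  (≈-combine 1ℤ 0ℤ (periodic a) (trans
    (ring₁ (∑ℤ[ i < p ] g (suc a ℕ.+ i)) (g a))
    (trans (cong (_- g a) (trans (cong₂ _+_ (cong g (sym (ℕ.+-identityʳ a)))
        (∑-cong p λ i _ → cong g (sym (ℕ.+-suc a i)))) (∑-last p (λ i → g (a ℕ.+ i)))))
      (trans (cong (λ t → ∑ℤ p (λ i → g (a ℕ.+ i)) + g t - g a) (ℕ.+-comm a p))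
        (ring₂ (∑ℤ[ i < p ] g (a ℕ.+ i)) (g (p ℕ.+ a)) (g a) M)))))
  (∑-shift p g periodic a)
  where
  ring₁ : ∀ s x → s ≡ x + s - x
  ring₁ = solve-∀
  ring₂ : ∀ s y x M → s + y - x ≡ s + 1ℤ * (y - x) + 0ℤ * M
  ring₂ = solve-∀

-- Euler numbers

-- Unfolds to the conditional in `E-recursion`, so that the recursions of `E` and `pseudoEuler` have
-- the same shape.
evenPart : ℕ → ℤ → ℤ
evenPart k x = if does (2 ∣? k) then x else 0ℤ

sign-parity : ∀ k → (2 ∣ k × -1ℤ ^ k ≡ 1ℤ) ⊎ (2 ∣ suc k × -1ℤ ^ k ≡ -1ℤ)
sign-parity zero = inj₁ (2 ∣0 , refl)
sign-parity (suc k) with sign-parity k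
... | inj₁ (2∣k , s≡1)  = inj₂ (∣m∣n⇒∣m+n ∣-refl 2∣k , cong (_*_ -1ℤ) s≡1)
... | inj₂ (2∣1+k , s≡-1) = inj₁ (2∣1+k , cong (_*_ -1ℤ) s≡-1)

2∣1+k⇒2∤k : ∀ k → 2 ∣ suc k → ¬ 2 ∣ k
2∣1+k⇒2∤k k 2∣1+k 2∣k = >⇒∤ (s≤s (s≤s z≤n)) (∣m+n∣m⇒∣n (subst (2 ∣_) (ℕ.+-comm 1 k) 2∣1+k) 2∣k)

-- Writing the indicator of evenness as (1 + (-1)^k)/2 turns the recursion into two binomial
-- expansions.
double-evenPart : ∀ k x → + 2 * evenPart k x ≡ (1ℤ + -1ℤ ^ k) * x
double-evenPart k x with sign-parity k
... | inj₁ (2∣k , s≡1)    rewrite dec-true (2 ∣? k) 2∣k | s≡1 = refl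
... | inj₂ (2∣1+k , s≡-1) rewrite dec-false (2 ∣? k) (2∣1+k⇒2∤k k 2∣1+k) | s≡-1 = sym (ℤ.*-zeroˡ x)

evenPart-≈ : ∀ {M x y} k → x ≈ y [ M ] → evenPart k x ≈ evenPart k y [ M ]
evenPart-≈ k x≈y with does (2 ∣? k)
... | true  = x≈y
... | false = ≈-refl

-- Σ_{i=-m}^{m} (-1)^i g(i)
symmetricSum : ℕ → (ℤ → ℤ) → ℤ
symmetricSum zero    g = g 0ℤ
symmetricSum (suc m) g = symmetricSum m g + -1ℤ ^ suc m * (g (+ suc m) + g (- + suc m))

symmetricSum-cong : ∀ m {g h : ℤ → ℤ} → (∀ y → g y ≡ h y) → symmetricSum m g ≡ symmetricSum m h
symmetricSum-cong zero    g≡h = g≡h 0ℤ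
symmetricSum-cong (suc m) g≡h = cong₂ _+_ (symmetricSum-cong m g≡h)
  (cong (_*_ (-1ℤ ^ suc m)) (cong₂ _+_ (g≡h (+ suc m)) (g≡h (- + suc m))))

∑-symmetricSum : ∀ n m (w : ℕ → ℤ) (g : ℕ → ℤ → ℤ) →
  (∑ℤ[ k < n ] (w k * symmetricSum m (g k))) ≡ symmetricSum m (λ y → ∑ℤ[ k < n ] (w k * g k y))
∑-symmetricSum n zero    w g = refl
∑-symmetricSum n (suc m) w g = begin
  (∑ℤ[ k < n ] (w k * (symmetricSum m (g k) + s * (g k a + g k b))))
    ≡⟨ ∑-cong n (λ k _ → ring (w k) (symmetricSum m (g k)) s (g k a) (g k b)) ⟩
  (∑ℤ[ k < n ] (w k * symmetricSum m (g k) + s * (w k * g k a + w k * g k b)))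
    ≡⟨ ∑-+ n (λ k → w k * symmetricSum m (g k)) (λ k → s * (w k * g k a + w k * g k b)) ⟩
  (∑ℤ[ k < n ] (w k * symmetricSum m (g k))) + (∑ℤ[ k < n ] (s * (w k * g k a + w k * g k b)))
    ≡⟨ cong₂ _+_ (∑-symmetricSum n m w g)
         (trans (∑-*ˡ n s (λ k → w k * g k a + w k * g k b))
           (cong (_*_ s) (∑-+ n (λ k → w k * g k a) (λ k → w k * g k b)))) ⟩
  symmetricSum (suc m) (λ y → ∑ℤ[ k < n ] (w k * g k y)) ∎
  where
  open ≡-Reasoning
  s a b : ℤ
  s = -1ℤ ^ suc m
  a = + suc m
  b = - + suc m
  ring : ∀ w t s a b → w * (t + s * (a + b)) ≡ w * t + s * (w * a + w * b)
  ring = solve-∀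

-- An odd number strictly between the extremes is both 2y + 1 and 2(y+1) - 1, with opposite signs;
-- the two extremes survive.
symmetricSum-telescope : ∀ m (h : ℤ → ℤ) →
  symmetricSum m (λ y → h (1ℤ + + 2 * y) + h (-1ℤ + + 2 * y)) ≡
  -1ℤ ^ m * (h (+ suc (m ℕ.+ m)) + h (- + suc (m ℕ.+ m)))
symmetricSum-telescope zero    h = sym (ℤ.*-identityˡ _)
symmetricSum-telescope (suc m) h
  rewrite symmetricSum-telescope m h
  = trans (cong₂ (λ u v → -1ℤ ^ m * (a + b) + -1ℤ ^ suc m * (u + v))
      (cong₂ _+_ (cong h (trans (ring₁ (+ m)) 2m+3)) (cong h (ring₂ (+ m))))
      (cong₂ _+_ (cong h (ring₃ (+ m))) (cong h (trans (ring₄ (+ m)) (cong -_ 2m+3)))))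
    (ring₅ (-1ℤ ^ m) a b (h (+ suc (suc m ℕ.+ suc m))) (h (- + suc (suc m ℕ.+ suc m))))
  where
  a b : ℤ
  a = h (+ suc (m ℕ.+ m))
  b = h (- + suc (m ℕ.+ m))
  2m+3 : 1ℤ + ((1ℤ + + m) + (1ℤ + + m)) ≡ + suc (suc m ℕ.+ suc m)
  2m+3 = refl
  ring₁ : ∀ m → 1ℤ + + 2 * (1ℤ + m) ≡ 1ℤ + ((1ℤ + m) + (1ℤ + m))
  ring₁ = solve-∀
  ring₂ : ∀ m → - 1ℤ + + 2 * (1ℤ + m) ≡ 1ℤ + (m + m)
  ring₂ = solve-∀
  ring₃ : ∀ m → 1ℤ + + 2 * (- (1ℤ + m)) ≡ - (1ℤ + (m + m))
  ring₃ = solve-∀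
  ring₄ : ∀ m → - 1ℤ + + 2 * (- (1ℤ + m)) ≡ - (1ℤ + ((1ℤ + m) + (1ℤ + m)))
  ring₄ = solve-∀
  ring₅ : ∀ s a b u v → s * (a + b) + - 1ℤ * s * ((u + a) + (b + v)) ≡ - 1ℤ * s * (u + v)
  ring₅ = solve-∀

symmetricSum-1 : ∀ m → symmetricSum m (λ _ → 1ℤ) ≡ -1ℤ ^ m
symmetricSum-1 zero    = refl
symmetricSum-1 (suc m) rewrite symmetricSum-1 m = ring (-1ℤ ^ m)
  where
  ring : ∀ s → s + - 1ℤ * s * + 2 ≡ - 1ℤ * s
  ring = solve-∀

-- Agrees with the Euler number E n modulo 2m + 1, as it satisfies the same recursion.
pseudoEuler : ℕ → ℕ → ℤ
pseudoEuler m n = -1ℤ ^ m * symmetricSum m (λ y → (+ 2 * y) ^ n)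

-- The even part of the binomial expansion of (1 + 2y)^n, doubled, is (1 + 2y)^n + (-1 + 2y)^n, and
-- the alternating sum over y telescopes. For n > 0 the remainder is divisible by 2m + 1.
pseudoEuler-rec : ∀ m n → + 2 * (∑ℤ[ k < suc n ] evenPart k (binom n k * pseudoEuler m (n ∸ k))) ≡
  (+ suc (m ℕ.+ m)) ^ n + (- + suc (m ℕ.+ m)) ^ n
pseudoEuler-rec m n = begin
  + 2 * (∑ℤ[ k < suc n ] evenPart k (binom n k * pseudoEuler m (n ∸ k)))
    ≡⟨ ∑-*ˡ (suc n) (+ 2) (λ k → evenPart k (binom n k * pseudoEuler m (n ∸ k))) ⟨
  (∑ℤ[ k < suc n ] (+ 2 * evenPart k (binom n k * pseudoEuler m (n ∸ k))))
    ≡⟨ ∑-cong (suc n) (λ k _ → trans (double-evenPart k (binom n k * pseudoEuler m (n ∸ k)))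
         (ring₁ k (binom n k) (-1ℤ ^ m) (symmetricSum m (g k)))) ⟩
  (∑ℤ[ k < suc n ] (-1ℤ ^ m * (w k * symmetricSum m (g k))))
    ≡⟨ ∑-*ˡ (suc n) (-1ℤ ^ m) (λ k → w k * symmetricSum m (g k)) ⟩
  -1ℤ ^ m * (∑ℤ[ k < suc n ] (w k * symmetricSum m (g k)))
    ≡⟨ cong (_*_ (-1ℤ ^ m)) (trans (∑-symmetricSum (suc n) m w g) (symmetricSum-cong m expand)) ⟩
  -1ℤ ^ m * symmetricSum m (λ y → (1ℤ + + 2 * y) ^ n + (-1ℤ + + 2 * y) ^ n)
    ≡⟨ cong (_*_ (-1ℤ ^ m)) (symmetricSum-telescope m (_^ n)) ⟩
  -1ℤ ^ m * (-1ℤ ^ m * (u + v))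
    ≡⟨ ring₂ (-1ℤ ^ m) (u + v) ⟩
  -1ℤ ^ m * -1ℤ ^ m * (u + v)
    ≡⟨ cong (_* (u + v)) (sign-square m) ⟩
  1ℤ * (u + v)
    ≡⟨ ℤ.*-identityˡ (u + v) ⟩
  u + v ∎
  where
  open ≡-Reasoning
  u v : ℤ
  u = (+ suc (m ℕ.+ m)) ^ n
  v = (- + suc (m ℕ.+ m)) ^ n
  w : ℕ → ℤ
  w k = binom n k * (1ℤ ^ k + -1ℤ ^ k)
  g : ℕ → ℤ → ℤ
  g k y = (+ 2 * y) ^ (n ∸ k)
  ring₀ : ∀ s b t x → (1ℤ + s) * (b * (t * x)) ≡ t * (b * (1ℤ + s) * x)
  ring₀ = solve-∀
  ring₁ : ∀ k b t x → (1ℤ + -1ℤ ^ k) * (b * (t * x)) ≡ t * (b * (1ℤ ^ k + -1ℤ ^ k) * x)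
  ring₁ k b t x = trans (ring₀ (-1ℤ ^ k) b t x) (cong (λ o → t * (b * (o + -1ℤ ^ k) * x)) (sym (ℤ.^-zeroˡ k)))
  ring₂ : ∀ s x → s * (s * x) ≡ s * s * x
  ring₂ = solve-∀
  ring₃ : ∀ b o s x → b * (o + s) * x ≡ b * (o * x) + b * (s * x)
  ring₃ = solve-∀
  expand : ∀ y → (∑ℤ[ k < suc n ] (w k * g k y)) ≡ (1ℤ + + 2 * y) ^ n + (-1ℤ + + 2 * y) ^ n
  expand y = trans (∑-cong (suc n) λ k _ → ring₃ (binom n k) (1ℤ ^ k) (-1ℤ ^ k) (g k y))
    (trans (∑-+ (suc n) (λ k → binom n k * (1ℤ ^ k * g k y)) (λ k → binom n k * (-1ℤ ^ k * g k y)))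
      (cong₂ _+_ (binomial-theorem n 1ℤ (+ 2 * y)) (binomial-theorem n -1ℤ (+ 2 * y))))

module _ (m : ℕ) (p-prime : Prime (suc (m ℕ.+ m))) (p∤2 : ¬ suc (m ℕ.+ m) ∣ 2) where

  private
    P : ℤ
    P = + suc (m ℕ.+ m)

  -P≈0 : - P ≈ 0ℤ [ P ^ 1 ]
  -P≈0 = -1ℤ , ring P
    where
    ring : ∀ P → - P ≡ 0ℤ + - 1ℤ * (P * 1ℤ)
    ring = solve-∀

  pseudoEuler-rec-≈ : ∀ n →
    (∑ℤ[ k < suc (suc n) ] evenPart k (binom (suc n) k * pseudoEuler m (suc n ∸ k))) ≈ 0ℤ [ P ^ 1 ]
  pseudoEuler-rec-≈ n = ≈-cancel p-prime 1 (+ 2) p∤2 (≈-trans (≈-reflexive (pseudoEuler-rec m (suc n)))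
    (≈-trans (+-≈ (*-≈ (p≈0 {suc (m ℕ.+ m)}) (≈-refl {x = P ^ n})) (*-≈ -P≈0 (≈-refl {x = (- P) ^ n})))
      (≈-reflexive (ring (P ^ n) ((- P) ^ n)))))
    where
    ring : ∀ x y → 0ℤ * x + 0ℤ * y ≡ + 2 * 0ℤ
    ring = solve-∀

  E-≈ : ∀ n → E n ≈ pseudoEuler m n [ P ^ 1 ]
  E-≈ = <-rec (λ n → E n ≈ pseudoEuler m n [ P ^ 1 ]) step
    where
    step : ∀ n → (∀ {i} → i < n → E i ≈ pseudoEuler m i [ P ^ 1 ]) → E n ≈ pseudoEuler m n [ P ^ 1 ]
    -- Every summand is 1, also at y = 0 since `0 ^ 0` is 1; the prefactor of `pseudoEuler` cancels
    -- the resulting sign.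
    step zero    _   = ≈-reflexive (sym (trans (cong (_*_ (-1ℤ ^ m)) (symmetricSum-1 m)) (sign-square m)))
    step (suc n) rec = ≈-combine (- 1ℤ) 0ℤ tails
      (≡-combine 1ℤ (E-recursion (suc n)) (ring₁ (E (suc n)) T T′ P))
      ⟨≈⟩ ≈-combine (- 1ℤ) 0ℤ (pseudoEuler-rec-≈ n)
        (≡-combine (pseudoEuler m (suc n)) (binom-0 (suc n)) (ring₂ (binom (suc n) 0) (pseudoEuler m (suc n)) T′ P))
      where
      infixr 2 _⟨≈⟩_
      _⟨≈⟩_ = ≈-trans
      f f′ : ℕ → ℤ
      f  j = evenPart (suc j) (+ (suc n C suc j) * E (n ∸ j))
      f′ j = evenPart (suc j) (binom (suc n) (suc j) * pseudoEuler m (n ∸ j))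
      T T′ : ℤ
      T  = ∑ℤ (suc n) f
      T′ = ∑ℤ (suc n) f′
      tails : T ≈ T′ [ P ^ 1 ]
      tails = ∑-≈ (suc n) {f} {f′} λ j _ → evenPart-≈ (suc j)
        (*-≈ (≈-reflexive (sym (binom-C (suc n) (suc j)))) (rec (s≤s (ℕ.m∸n≤m n j))))
      ring₁ : ∀ E T T′ P → E ≡ - T′ + (- 1ℤ) * (T - T′) + 0ℤ * (P * 1ℤ) + 1ℤ * (1ℤ * E + T - 0ℤ)
      ring₁ = solve-∀
      ring₂ : ∀ b E T′ P → - T′ ≡ E + (- 1ℤ) * (b * E + T′ - 0ℤ) + 0ℤ * (P * 1ℤ) + E * (b - 1ℤ)
      ring₂ = solve-∀

neg-^-double : ∀ x n → (- x) ^ (n ℕ.+ n) ≡ x ^ (n ℕ.+ n)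
neg-^-double x zero    = refl
neg-^-double x (suc n) rewrite ℕ.+-suc n n | neg-^-double x n = ring x (x ^ (n ℕ.+ n))
  where
  ring : ∀ x y → - x * (- x * y) ≡ x * (x * y)
  ring = solve-∀

-- Reflection of the upper terms of the cubic sum

abstract
  -- Its cube is the denominator of `reciprocalTerm (suc k)`. Sealed for the same reason as `binom`.
  base : ℕ → ℕ
  base k = suc k ℕ.* ((suc k ℕ.+ suc k) C suc k)

  base-C : ∀ k → base k ≡ suc k ℕ.* ((suc k ℕ.+ suc k) C suc k)
  base-C k = refl

base-≡ : ∀ k → + base k ≡ + suc k * central (suc k)
base-≡ k = trans (cong +_ (base-C k)) (trans (ℤ.pos-* (suc k) _)
  (cong (_*_ (+ suc k)) (sym (binom-C (suc k ℕ.+ suc k) (suc k)))))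

-- The top terms are read backwards: for `p = suc N` the index `N ∸ k` is p - (k+1), the mirror
-- image of k + 1.
∑-top : ∀ N n (f : ℕ → ℤ) → n ≤ suc N → ∑ℤ (suc N) f ≡ ∑ℤ (suc N ∸ n) f + (∑ℤ[ k < n ] f (N ∸ k))
∑-top N zero    f _         = sym (ℤ.+-identityʳ _)
∑-top N (suc n) f (s≤s n≤N) = begin
  ∑ℤ (suc N) f                                    ≡⟨ ∑-top N n f (ℕ.m≤n⇒m≤1+n n≤N) ⟩
  ∑ℤ (suc N ∸ n) f + T                            ≡⟨ cong (λ t → ∑ℤ t f + T) (ℕ.+-∸-assoc 1 n≤N) ⟩
  ∑ℤ (suc (N ∸ n)) f + T                          ≡⟨ cong (_+ T) (∑-last (N ∸ n) f) ⟩
  ∑ℤ (N ∸ n) f + f (N ∸ n) + T                    ≡⟨ ring (∑ℤ (N ∸ n) f) (f (N ∸ n)) T ⟩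
  ∑ℤ (N ∸ n) f + (T + f (N ∸ n))                  ≡⟨ cong (_+_ (∑ℤ (N ∸ n) f)) (∑-last n λ k → f (N ∸ k)) ⟨
  ∑ℤ (N ∸ n) f + (∑ℤ[ k < suc n ] f (N ∸ k))      ∎
  where
  open ≡-Reasoning
  T : ℤ
  T = ∑ℤ[ k < n ] f (N ∸ k)
  ring : ∀ a b c → a + b + c ≡ a + (c + b)
  ring = solve-∀

-- Dividing B c ≡ -2P (mod P²) by P determines c / P modulo P, as -2 / B.
cube-lift : ∀ P .{{_ : ℤ.NonZero P}} K Q c B j → K + Q ≡ P → c ≈ 0ℤ [ P ^ 1 ] →
  B * c ≈ - (+ 2 * P) [ P ^ 2 ] → B * j ≈ 1ℤ [ P ^ 1 ] →
  (+ 21 * Q + + 8) * (c * c * c) ≈ P * (P * (P * (+ 8 * ((+ 21 * K - + 8) * (j * j * j))))) [ P ^ 4 ]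
cube-lift P K Q c B j K+Q≡P (d , c≡dP) Bc≈-2P Bj≈1 = ≈-trans
  (≈-reflexive (trans (cong (λ c → (+ 21 * Q + + 8) * (c * c * c)) c≡dP) (ring₁ Q d P)))
  (≈-scale P (≈-scale P (≈-scale P (≈-trans (*-≈ linear (*-≈ (*-≈ d≈ d≈) d≈))
    (≈-reflexive (ring₂ K j))))))
  where
  ring₁ : ∀ Q d P → (+ 21 * Q + + 8) * ((0ℤ + d * (P * 1ℤ)) * (0ℤ + d * (P * 1ℤ)) * (0ℤ + d * (P * 1ℤ))) ≡
    P * (P * (P * ((+ 21 * Q + + 8) * (d * d * d))))
  ring₁ = solve-∀
  -- The cube of -2 supplies the 8, and its sign turns 8 - 21K into 21K - 8.
  ring₂ : ∀ K j → (+ 8 - + 21 * K) * ((- + 2 * j) * (- + 2 * j) * (- + 2 * j)) ≡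
    + 8 * ((+ 21 * K - + 8) * (j * j * j))
  ring₂ = solve-∀
  linear : + 21 * Q + + 8 ≈ + 8 - + 21 * K [ P ^ 1 ]
  linear = + 21 , ≡-combine (+ 21) K+Q≡P (ring K Q P)
    where
    ring : ∀ K Q P → + 21 * Q + + 8 ≡ + 8 - + 21 * K + + 21 * (P * 1ℤ) + + 21 * (K + Q - P)
    ring = solve-∀
  Bd≈-2 : B * d ≈ - + 2 [ P ^ 1 ]
  Bd≈-2 = ≈-unscale {P ^ 1} P (≈-trans (≈-reflexive (trans (ring B d P) (cong (_*_ B) (sym c≡dP))))
    (≈-trans Bc≈-2P (≈-reflexive (ring′ P))))
    where
    ring : ∀ b d P → P * (b * d) ≡ b * (0ℤ + d * (P * 1ℤ))
    ring = solve-∀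
    ring′ : ∀ P → - (+ 2 * P) ≡ P * - + 2
    ring′ = solve-∀
  d≈ : d ≈ - + 2 * j [ P ^ 1 ]
  d≈ = ≈-trans (≈-combine (- d) 0ℤ Bj≈1 (ring B j d P)) (*-≈ Bd≈-2 (≈-refl {x = j}))
    where
    ring : ∀ b j d P → d ≡ b * d * j + (- d) * (b * j - 1ℤ) + 0ℤ * (P * 1ℤ)
    ring = solve-∀

-- The two terms `8 P` cancel; all that remains carries P³, and dividing it out lowers the modulus
-- from P⁴ to P.
upper-half : ∀ P .{{_ : ℤ.NonZero P}} {T S U} X Z → T ≡ S + U → T ≈ + 8 * P [ P ^ 4 ] →
  S ≈ + 8 * P + + 16 * (P * (P * (P * X))) [ P ^ 4 ] → U ≈ P * (P * (P * (+ 8 * Z))) [ P ^ 4 ] →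
  + 8 * Z ≈ - (+ 16 * X) [ P ^ 1 ]
upper-half P {_} {S} {U} X Z refl T≈ S≈ U≈ =
  ≈-unscale {P ^ 1} P (≈-unscale {P ^ 2} P (≈-unscale {P ^ 3} P
    (≈-trans (≈-sym U≈) (≈-trans (≈-combine (- 1ℤ) 0ℤ S≈ (ring₁ S U (+ 8 * P + + 16 * (P * (P * (P * X)))) (P ^ 4)))
      (≈-trans (+-≈ T≈ ≈-refl) (≈-reflexive (ring₂ P X)))))))
  where
  ring₁ : ∀ S U a M → U ≡ S + U + - a + (- 1ℤ) * (S - a) + 0ℤ * M
  ring₁ = solve-∀
  ring₂ : ∀ P X → + 8 * P + - (+ 8 * P + + 16 * (P * (P * (P * X)))) ≡ P * (P * (P * (- (+ 16 * X))))
  ring₂ = solve-∀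

∤-≈ : ∀ {p x y} → x ≈ y [ (+ p) ^ 1 ] → ¬ p ∣ ∣ y ∣ → ¬ p ∣ ∣ x ∣
∤-≈ {p} {x} {y} x≈y p∤y p∣x = p∤y (subst (_∣ ∣ y ∣) (ℕ.*-identityʳ p) (subst (_∣ ∣ y ∣) (ℤ.abs-* (+ p) 1ℤ)
  (≈⇒∣ (≈-trans (≈-sym x≈y) (∣⇒≈ {(+ p) ^ 1} {x} (subst (_∣ ∣ x ∣) (sym (trans (ℤ.abs-* (+ p) 1ℤ) (ℕ.*-identityʳ p))) p∣x))))))

-- Congruences between rationals

pos-^ : ∀ p a → + (p ℕ.^ a) ≡ (+ p) ^ a
pos-^ p zero    = refl
pos-^ p (suc a) = trans (ℤ.pos-* p (p ℕ.^ a)) (cong (_*_ (+ p)) (pos-^ p a))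

↧ₙ-/∣ : ∀ n d .{{_ : NonZero d}} → ↧ₙ (n ℚ./ d) ∣ d
↧ₙ-/∣ n d = divides ∣ g ∣ (trans (cong ∣_∣ (sym (ℚ.↧-/ n d)))
  (trans (ℤ.abs-* (ℚ.↧ (n ℚ./ d)) g) (ℕ.*-comm (↧ₙ (n ℚ./ d)) ∣ g ∣)))
  where
  open import Data.Integer.GCD using (gcd)
  g : ℤ
  g = gcd n (+ d)

↧ₙ-+∣ : ∀ x y → ↧ₙ (x ℚ.+ y) ∣ ↧ₙ x ℕ.* ↧ₙ y
↧ₙ-+∣ x@record{} y@record{} = ↧ₙ-/∣ (ℚ.↥ x * ℚ.↧ y + ℚ.↥ y * ℚ.↧ x) (↧ₙ x ℕ.* ↧ₙ y)

module _ {p : ℕ} (p-prime : Prime p) where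

  Integral-/ : ∀ n d .{{_ : NonZero d}} → ¬ p ∣ d → Integral p (n ℚ./ d)
  Integral-/ n d p∤d p∣ = p∤d (∣-trans p∣ (↧ₙ-/∣ n d))

  Integral-+ : ∀ x y → Integral p x → Integral p y → Integral p (x ℚ.+ y)
  Integral-+ x y px py p∣ =
    [ px , py ]′ (euclidsLemma (↧ₙ x) (↧ₙ y) p-prime (∣-trans p∣ (↧ₙ-+∣ x y)))

  mod-trans : ∀ {a x y z} → x ≡ y [mod p ^ a ] → y ≡ z [mod p ^ a ] → x ≡ z [mod p ^ a ]
  mod-trans {a} {x} {y} {z} (px , _ , c , pc , eq) (_ , pz , c′ , pc′ , eq′) =
    px , pz , c ℚ.+ c′ , Integral-+ c c′ pc pc′ , trans (ring₁ x y z)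
      (trans (cong₂ ℚ._+_ eq eq′) (sym (ℚ.*-distribˡ-+ (fromℤ (+ (p ℕ.^ a))) c c′)))
    where
    open +-*-Solver
    ring₁ : ∀ x y z → x ℚ.- z ≡ (x ℚ.- y) ℚ.+ (y ℚ.- z)
    ring₁ = solve 3 (λ x y z → x :- z := (x :- y) :+ (y :- z)) refl

  mod-+ : ∀ {a x y u v} → x ≡ y [mod p ^ a ] → u ≡ v [mod p ^ a ] → x ℚ.+ u ≡ y ℚ.+ v [mod p ^ a ]
  mod-+ {a} {x} {y} {u} {v} (px , py , c , pc , eq) (pu , pv , c′ , pc′ , eq′) =
    Integral-+ x u px pu , Integral-+ y v py pv , c ℚ.+ c′ , Integral-+ c c′ pc pc′ , trans (ring₁ x y u v)
      (trans (cong₂ ℚ._+_ eq eq′) (sym (ℚ.*-distribˡ-+ (fromℤ (+ (p ℕ.^ a))) c c′)))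
    where
    open +-*-Solver
    ring₁ : ∀ x y u v → (x ℚ.+ u) ℚ.- (y ℚ.+ v) ≡ (x ℚ.- y) ℚ.+ (u ℚ.- v)
    ring₁ = solve 4 (λ x y u v → (x :+ u) :- (y :+ v) := (x :- y) :+ (u :- v)) refl

p∤1 : ∀ {p} → Prime p → ¬ p ∣ 1
p∤1 {suc (suc p)} _ = >⇒∤ (s≤s (s≤s z≤n))

-- Carried out in the unnormalised rationals, where numerators and denominators are explicit instead
-- of divided by a gcd.
/-difference : ∀ n z M c d .{{_ : NonZero d}} → + d * z ≡ n + c * M →
  n ℚ./ d ℚ.- fromℤ z ≡ fromℤ M ℚ.* ((- c) ℚ./ d)
/-difference n z M c (suc d) eq = ℚ.toℚᵘ-injective (begin
  toℚᵘ (n ℚ./ suc d ℚ.- fromℤ z)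
    ≈⟨ ℚ.toℚᵘ-homo-+ (n ℚ./ suc d) (ℚ.- fromℤ z) ⟩
  toℚᵘ (n ℚ./ suc d) ℚᵘ.+ toℚᵘ (ℚ.- fromℤ z)
    ≈⟨ ℚᵘ.+-cong (ℚ.toℚᵘ-fromℚᵘ (mkℚᵘ n d))
         (ℚᵘ.≃-trans (ℚ.toℚᵘ-homo‿- (fromℤ z)) (ℚᵘ.-‿cong (ℚ.toℚᵘ-fromℚᵘ (mkℚᵘ z 0)))) ⟩
  mkℚᵘ n d ℚᵘ.- mkℚᵘ z 0
    ≈⟨ *≡* (trans (cong (λ x → (n * 1ℤ + - z * + suc d) * + x) (ℕ.*-identityˡ (suc d)))
         (trans (≡-combine (- + suc d) eq (ring n z M c (+ suc d)))
           (cong (λ x → M * - c * + x) (sym (ℕ.*-identityʳ (suc d)))))) ⟩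
  mkℚᵘ M 0 ℚᵘ.* mkℚᵘ (- c) d
    ≈⟨ ℚᵘ.*-cong (ℚ.toℚᵘ-fromℚᵘ (mkℚᵘ M 0)) (ℚ.toℚᵘ-fromℚᵘ (mkℚᵘ (- c) d)) ⟨
  toℚᵘ (fromℤ M) ℚᵘ.* toℚᵘ ((- c) ℚ./ suc d)
    ≈⟨ ℚ.toℚᵘ-homo-* (fromℤ M) ((- c) ℚ./ suc d) ⟨
  toℚᵘ (fromℤ M ℚ.* ((- c) ℚ./ suc d)) ∎)
  where
  open import Relation.Binary.Reasoning.Setoid ℚᵘ.≃-setoid
  ring : ∀ n z M c d → (n * 1ℤ + - z * d) * d ≡ M * - c * d + (- d) * (d * z - (n + c * M))
  ring = solve-∀

-- The bridge to the rationals: cross-multiplied, a congruence between a fraction and an integer is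
-- one between integers.
/-≈ : ∀ {p} → Prime p → ∀ a n d z .{{_ : NonZero d}} → ¬ p ∣ d → + d * z ≈ n [ (+ p) ^ a ] →
  n ℚ./ d ≡ fromℤ z [mod p ^ a ]
/-≈ {p} p-prime a n d z p∤d (c , eq) =
  Integral-/ p-prime n d p∤d , Integral-/ p-prime z 1 (p∤1 p-prime) ,
  (- c) ℚ./ d , Integral-/ p-prime (- c) d p∤d ,
  /-difference n z (+ (p ℕ.^ a)) c d (trans eq (cong (λ t → n + c * t) (sym (pos-^ p a))))

fromℤ-≈ : ∀ {p} → Prime p → ∀ a {x y} → x ≈ y [ (+ p) ^ a ] → fromℤ x ≡ fromℤ y [mod p ^ a ]
fromℤ-≈ p-prime a {x} {y} x≈y = /-≈ p-prime a x 1 y (p∤1 p-prime)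
  (≈-trans (≈-reflexive (ℤ.*-identityˡ y)) (≈-sym x≈y))

fromℤ-+ : ∀ x y → fromℤ (x + y) ≡ fromℤ x ℚ.+ fromℤ y
fromℤ-+ x y = ℚ.toℚᵘ-injective (begin
  toℚᵘ (fromℤ (x + y))                ≈⟨ ℚ.toℚᵘ-fromℚᵘ (mkℚᵘ (x + y) 0) ⟩
  mkℚᵘ (x + y) 0                      ≈⟨ *≡* (ring x y) ⟩
  mkℚᵘ x 0 ℚᵘ.+ mkℚᵘ y 0              ≈⟨ ℚᵘ.+-cong (ℚ.toℚᵘ-fromℚᵘ (mkℚᵘ x 0)) (ℚ.toℚᵘ-fromℚᵘ (mkℚᵘ y 0)) ⟨
  toℚᵘ (fromℤ x) ℚᵘ.+ toℚᵘ (fromℤ y)  ≈⟨ ℚ.toℚᵘ-homo-+ (fromℤ x) (fromℤ y) ⟨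
  toℚᵘ (fromℤ x ℚ.+ fromℤ y) ∎)
  where
  open import Relation.Binary.Reasoning.Setoid ℚᵘ.≃-setoid
  ring : ∀ x y → (x + y) * 1ℤ ≡ (x * 1ℤ + y * 1ℤ) * 1ℤ
  ring = solve-∀

∑ℚ-≈ : ∀ {p} → Prime p → ∀ a n {f : ℕ → ℚ} {g : ℕ → ℤ} → (∀ i → i < n → f i ≡ fromℤ (g i) [mod p ^ a ]) →
  ∑ℚ n f ≡ fromℤ (∑ℤ n g) [mod p ^ a ]
∑ℚ-≈ p-prime a zero    f≈g = fromℤ-≈ p-prime a {0ℤ} {0ℤ} ≈-refl
∑ℚ-≈ {p} p-prime a (suc n) {f} {g} f≈g =
  subst (λ t → ∑ℚ (suc n) f ≡ t [mod p ^ a ]) (sym (fromℤ-+ (g 0) (∑ℤ n (g ∘ suc))))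
    (mod-+ p-prime {a} {f 0} {fromℤ (g 0)} {∑ℚ n (f ∘ suc)} {fromℤ (∑ℤ n (g ∘ suc))}
      (f≈g 0 (s≤s z≤n)) (∑ℚ-≈ p-prime a n {f ∘ suc} {g ∘ suc} λ i i<n → f≈g (suc i) (s≤s i<n)))

-- Matching the shape of the statement

-- In this shape `p ∸ 1` and `p ∸ 3` compute to successors, so that `E (p ∸ 3)` and the exponent of
-- `ρ` agree by computation.
odd-prime : ∀ p → Prime p → 3 < p → ∃[ μ ] p ≡ 5 ℕ.+ (μ ℕ.+ μ)
odd-prime p p-prime 3<p = from-half (p / 2) p≡1+half*2
  where
  2∤p : ¬ 2 ∣ p
  2∤p 2∣p with prime⇒irreducible p-prime 2∣p
  ... | inj₁ ()
  ... | inj₂ refl = contradiction 3<p (λ { (s≤s (s≤s ())) })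
  remainder : ∀ r → r < 2 → p ≡ r ℕ.+ p / 2 ℕ.* 2 → p ≡ 1 ℕ.+ p / 2 ℕ.* 2
  remainder 0 _ eq = contradiction (divides (p / 2) eq) 2∤p
  remainder 1 _ eq = eq
  remainder (suc (suc _)) (s≤s (s≤s ())) _
  p≡1+half*2 : p ≡ 1 ℕ.+ p / 2 ℕ.* 2
  p≡1+half*2 = remainder (p % 2) (m%n<n p 2) (m≡m%n+[m/n]*n p 2)
  from-half : ∀ h → p ≡ 1 ℕ.+ h ℕ.* 2 → ∃[ μ ] p ≡ 5 ℕ.+ (μ ℕ.+ μ)
  from-half 0 refl = contradiction 3<p (λ { (s≤s ()) })
  from-half 1 refl = contradiction 3<p (λ { (s≤s (s≤s (s≤s ()))) })
  from-half (suc (suc μ)) eq = μ , trans eq (cong (5 ℕ.+_) (trans (ℕ.*-comm μ 2) (cong (μ ℕ.+_) (ℕ.+-identityʳ μ))))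

double/2 : ∀ h → (h ℕ.+ h) / 2 ≡ h
double/2 h = trans (cong (_/ 2) (trans (cong (h ℕ.+_) (sym (ℕ.+-identityʳ h))) (ℕ.*-comm 2 h))) (m*n/n≡m h 2)

cubicTerm-C : ∀ k → (+ 21 * + k + + 8) * (+ ((2 ℕ.* k) C k)) ^ 3 ≡ cubicTerm k
cubicTerm-C k = trans
  (cong (λ c → (+ 21 * + k + + 8) * c ^ 3)
    (trans (cong (λ n → + (n C k)) (cong (k ℕ.+_) (ℕ.+-identityʳ k))) (sym (binom-C (k ℕ.+ k) k))))
  (cong (_*_ (+ 21 * + k + + 8)) (ring (central k)))
  where
  ring : ∀ c → c * (c * (c * 1ℤ)) ≡ c * c * c
  ring = solve-∀

lower-half : ∀ P {S} X s E → S ≈ + 8 * P + + 16 * (P * (P * (P * X))) [ P ^ 4 ] →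
  + 16 * X ≈ + 32 * (s * E) [ P ^ 1 ] → S ≈ + 8 * P + s * + 32 * P ^ 3 * E [ P ^ 4 ]
lower-half P X s E S≈ X≈ = ≈-trans S≈ (≈-trans (≈-reflexive (ring₁ P X))
  (≈-trans (+-≈ˡ (+ 8 * P) (≈-scale P (≈-scale P (≈-scale P X≈)))) (≈-reflexive (ring₂ P s E))))
  where
  ring₁ : ∀ P X → + 8 * P + + 16 * (P * (P * (P * X))) ≡ + 8 * P + P * (P * (P * (+ 16 * X)))
  ring₁ = solve-∀
  ring₂ : ∀ P s E → + 8 * P + P * (P * (P * (+ 32 * (s * E)))) ≡ + 8 * P + s * + 32 * (P * (P * (P * 1ℤ))) * E
  ring₂ = solve-∀

cube-inverse : ∀ {M} b j n → b * j ≈ 1ℤ [ M ] → b * b * b * (n * (j * j * j)) ≈ n [ M ]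
cube-inverse b j n bj≈1 = ≈-trans (≈-reflexive (ring₁ b j n))
  (≈-trans (*-≈ˡ n (*-≈ (*-≈ bj≈1 bj≈1) bj≈1)) (≈-reflexive (ℤ.*-identityʳ n)))
  where
  ring₁ : ∀ b j n → b * b * b * (n * (j * j * j)) ≡ n * (b * j * (b * j) * (b * j))
  ring₁ = solve-∀

-- Inverse squares modulo p = 2μ + 5

module _ (μ : ℕ) (p-prime : Prime (5 ℕ.+ (μ ℕ.+ μ))) where

  -- p = 2m + 1 with m = μ + 2, and ρ k = k^(p-3) inverts k² modulo p, by Fermat.
  private
    e N p m : ℕ
    e = suc (suc (μ ℕ.+ μ))
    N = suc (suc e)
    p = suc N
    m = suc (suc μ)
    P : ℤ
    P = + p

  ρ : ℕ → ℤ
  ρ k = (+ k) ^ e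

  ρ-inverse : ∀ k → ¬ p ∣ k → + k * + k * ρ k ≈ 1ℤ [ P ^ 1 ]
  ρ-inverse k p∤k = ≈-cancel p-prime 1 (+ k) p∤k (≈-trans
    (≈-reflexive (ring (+ k) (ρ k))) (≈-trans (fermat p-prime k) (≈-reflexive (sym (ℤ.*-identityʳ (+ k))))))
    where
    ring : ∀ k r → k * (k * k * r) ≡ k * (k * (k * r))
    ring = solve-∀

  -- As 2 is invertible, the even and the odd arguments below 2p each contribute 2^(p-3) σ
  -- to 2 σ; multiplying by 4 leaves 8 σ ≡ 2 σ.
  ρ-sum : ∑ℤ p ρ ≈ 0ℤ [ P ^ 1 ]
  ρ-sum = ≈-cancel p-prime 1 (+ 6) (∤-* p-prime {+ 2} {+ 3} (below-∤ p-prime (s≤s (s≤s z≤n))) (below-∤ p-prime (s≤s (s≤s (s≤s z≤n)))))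
    (≈-trans (≈-combine (+ 4) 0ℤ doubled (ring₁ σ evens P))
    (≈-trans (≈-reflexive (cong (λ t → + 6 * σ - + 4 * (+ 2 * σ - + 2 * t)) evens-ρ))
    (≈-combine (+ 2 * σ) 0ℤ (ρ-inverse 2 (below-∤ p-prime (s≤s (s≤s z≤n)))) (ring₂ σ (ρ 2) P))))
    where
    σ : ℤ
    σ = ∑ℤ p ρ
    ring₁ : ∀ s t P → + 6 * s ≡ + 6 * s - + 4 * (+ 2 * s - + 2 * t) + + 4 * (+ 2 * s - + 2 * t) + 0ℤ * (P * 1ℤ)
    ring₁ = solve-∀
    ring₂ : ∀ s r P → + 6 * s - + 4 * (+ 2 * s - + 2 * (r * s)) ≡
      + 6 * 0ℤ + + 2 * s * (+ 2 * + 2 * r - 1ℤ) + 0ℤ * (P * 1ℤ)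
    ring₂ = solve-∀
    periodic : ∀ i → ρ (p ℕ.+ i) ≈ ρ i [ P ^ 1 ]
    periodic i = ^-≈ {P ^ 1} {+ (p ℕ.+ i)} {+ i} e (1ℤ , ring P (+ i))
      where
      ring : ∀ P i → P + i ≡ i + 1ℤ * (P * 1ℤ)
      ring = solve-∀
    evens odds : ℤ
    evens = ∑ℤ[ i < p ] ρ (i ℕ.+ i)
    odds  = ∑ℤ[ i < p ] ρ (suc (i ℕ.+ i))
    evens-ρ : evens ≡ ρ 2 * σ
    evens-ρ = trans (∑-cong p λ i _ → trans (cong (_^ e) (ring (+ i))) (^-distrib-* (+ 2) (+ i) e)) (∑-*ˡ p (ρ 2) ρ)
      where
      ring : ∀ i → i + i ≡ + 2 * i
      ring = solve-∀
    -- Modulo `p`, 2i + 1 is 2i + 1 + p = 2 (i + m + 1): the odd arguments are the even ones shifted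
    -- by `suc m` in i.
    odds≈evens : odds ≈ evens [ P ^ 1 ]
    odds≈evens = ≈-trans
      (∑-≈ p {λ i → ρ (suc (i ℕ.+ i))} {λ i → ρ ((suc m ℕ.+ i) ℕ.+ (suc m ℕ.+ i))} λ i _ →
        ≈-trans (≈-sym (periodic (suc (i ℕ.+ i)))) (≈-reflexive (cong ρ (ring₃ μ i))))
      (∑-shift p (λ i → ρ (i ℕ.+ i)) (λ i → ≈-trans (≈-reflexive (cong ρ (ring₄ (μ ℕ.+ μ) i)))
        (≈-trans (periodic (p ℕ.+ (i ℕ.+ i))) (periodic (i ℕ.+ i)))) (suc m))
      where
      ring₃ : ∀ μ i → (5 ℕ.+ (μ ℕ.+ μ)) ℕ.+ (1 ℕ.+ (i ℕ.+ i)) ≡ ((3 ℕ.+ μ) ℕ.+ i) ℕ.+ ((3 ℕ.+ μ) ℕ.+ i)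
      ring₃ = ℕRing.solve-∀
      ring₄ : ∀ ν i → (5 ℕ.+ ν ℕ.+ i) ℕ.+ (5 ℕ.+ ν ℕ.+ i) ≡ (5 ℕ.+ ν) ℕ.+ ((5 ℕ.+ ν) ℕ.+ (i ℕ.+ i))
      ring₄ = ℕRing.solve-∀
    doubled : + 2 * σ ≈ + 2 * evens [ P ^ 1 ]
    doubled = begin
      + 2 * σ                                 ≡⟨ double σ ⟩
      σ + σ                                   ≈⟨ +-≈ˡ σ (∑-≈ p {λ i → ρ (p ℕ.+ i)} {ρ} λ i _ → periodic i) ⟨
      σ + (∑ℤ[ i < p ] ρ (p ℕ.+ i))           ≡⟨ ∑-split p p ρ ⟨
      ∑ℤ (p ℕ.+ p) ρ                          ≡⟨ ∑-even-odd p ρ ⟩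
      evens + odds                            ≈⟨ +-≈ˡ evens odds≈evens ⟩
      evens + evens                           ≡⟨ double evens ⟨
      + 2 * evens ∎
      where
      open import Relation.Binary.Reasoning.Setoid (≈-setoid (P ^ 1))
      double : ∀ x → + 2 * x ≡ x + x
      double = solve-∀

  ρ-sum-suc : (∑ℤ[ k < N ] ρ (suc k)) ≈ 0ℤ [ P ^ 1 ]
  ρ-sum-suc = ≈-trans (≈-reflexive (sym (ℤ.+-identityˡ _))) ρ-sum

  -- The sum over all k < p

  -- As C is p c/(k+1), its square carries p², so knowing c² modulo `p` gives C² modulo p³.
  square-≈ : ∀ k {c C} → k < N → + suc k * C ≡ P * c → c * c ≈ 1ℤ [ P ^ 1 ] →
    C * C ≈ P * (P * ρ (suc k)) [ P ^ 3 ]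
  square-≈ k {c} {C} k<N kC≡Pc c²≈1 =
    ≈-cancel p-prime 3 (K * K) (∤-* p-prime {K} {K} p∤K p∤K) (begin
      K * K * (C * C)             ≡⟨ ring₁ K C ⟩
      K * C * (K * C)             ≡⟨ cong₂ _*_ kC≡Pc kC≡Pc ⟩
      P * c * (P * c)             ≡⟨ ring₂ P c ⟩
      P * (P * (c * c))           ≈⟨ ≈-scale P (≈-scale P (≈-trans c²≈1 (≈-sym (ρ-inverse (suc k) p∤K)))) ⟩
      P * (P * (K * K * ρ (suc k))) ≡⟨ ring₃ P K (ρ (suc k)) ⟩
      K * K * (P * (P * ρ (suc k))) ∎)
    where
    open import Relation.Binary.Reasoning.Setoid (≈-setoid (P ^ 3))
    K : ℤ
    K = + suc k
    p∤K = below-∤ p-prime k<N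
    ring₁ : ∀ K C → K * K * (C * C) ≡ K * C * (K * C)
    ring₁ = solve-∀
    ring₂ : ∀ P c → P * c * (P * c) ≡ P * (P * (c * c))
    ring₂ = solve-∀
    ring₃ : ∀ P K r → P * (P * (K * K * r)) ≡ K * K * (P * (P * r))
    ring₃ = solve-∀

  squares-≈ : ∀ {f : ℕ → ℤ} → (∀ k → k < N → f k ≈ P * (P * ρ (suc k)) [ P ^ 3 ]) → ∑ℤ N f ≈ 0ℤ [ P ^ 3 ]
  squares-≈ {f} f≈ = begin
    ∑ℤ N f                                  ≈⟨ ∑-≈ N f≈ ⟩
    (∑ℤ[ k < N ] (P * (P * ρ (suc k))))     ≡⟨ ∑-*ˡ N P (λ k → P * ρ (suc k)) ⟩
    P * (∑ℤ[ k < N ] (P * ρ (suc k)))       ≡⟨ cong (_*_ P) (∑-*ˡ N P (ρ ∘ suc)) ⟩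
    P * (P * (∑ℤ[ k < N ] ρ (suc k)))       ≈⟨ ≈-scale P (≈-scale P ρ-sum-suc) ⟩
    P * (P * 0ℤ)                            ≡⟨ ring P ⟩
    0ℤ ∎
    where
    open import Relation.Binary.Reasoning.Setoid (≈-setoid (P ^ 3))
    ring : ∀ P → P * (P * 0ℤ) ≡ 0ℤ
    ring = solve-∀

  -- Wolstenholme's congruence. In C(2p,p) = Σ C(p,k)² the inner terms are p²/k² modulo p³, and the
  -- inverse squares sum to 0 modulo `p`.
  central-p : central p ≈ + 2 [ P ^ 3 ]
  central-p = begin
    binom (p ℕ.+ p) p                 ≡⟨ cong (binom (p ℕ.+ p)) (ℕ.+-identityʳ p) ⟨
    binom (p ℕ.+ p) (p ℕ.+ 0)         ≡⟨ vandermonde p p 0 ⟨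
    ∑ℤ (suc p) f                      ≡⟨ ∑-last p f ⟩
    f 0 + ∑ℤ N (f ∘ suc) + f p        ≈⟨ +-≈ (+-≈ˡ (f 0) (squares-≈ {f ∘ suc} λ k k<N →
                                           square-≈ k k<N (binom-p p-prime k)
                                             (≈-trans (*-≈ (binom-≈ p-prime k (ℕ.<⇒≤ k<N)) (binom-≈ p-prime k (ℕ.<⇒≤ k<N)))
                                               (≈-reflexive (sign-square k))))) (≈-refl {x = f p}) ⟩
    f 0 + 0ℤ + f p                    ≡⟨ cong₂ (λ x y → x * x + 0ℤ + y * y) (binom-0 p) (binom-diag p) ⟩
    + 2 ∎
    where
    open import Relation.Binary.Reasoning.Setoid (≈-setoid (P ^ 3))
    f : ℕ → ℤ
    f k = binom p k * binom p k

  -- Since k C(p-1+k,k) = p C(p+k-1,k-1), the terms with k > 0 are again p²/k² modulo p³ and cancel.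
  squareSum-p : squareSum N ≈ 1ℤ [ P ^ 3 ]
  squareSum-p = ≈-trans (+-≈ (≈-reflexive (cong₂ _*_ (binom-0 (N ℕ.+ 0)) (binom-0 (N ℕ.+ 0))))
      (squares-≈ {f ∘ suc} λ k k<N → square-≈ k k<N (absorb k)
        (*-≈ (binom-shift-≈ p-prime k (ℕ.<⇒≤ k<N)) (binom-shift-≈ p-prime k (ℕ.<⇒≤ k<N)))))
    (≈-reflexive refl)
    where
    f : ℕ → ℤ
    f k = binom (N ℕ.+ k) k * binom (N ℕ.+ k) k
    absorb : ∀ k → + suc k * binom (N ℕ.+ suc k) (suc k) ≡ P * binom (p ℕ.+ k) k
    absorb k = trans (cong (λ t → + suc k * binom t (suc k)) (ℕ.+-suc N k))
      (trans (binom-suc (p ℕ.+ k) k) (cong (_* binom (p ℕ.+ k) k) (ring P (+ k))))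
      where
      ring : ∀ P k → P + k - k ≡ P
      ring = solve-∀

  -- As 2 (2p-1) C(2p-2,p-1) = p C(2p,p), the closed form is 4p C(2p,p) b(p-1), and this p lifts the
  -- congruences modulo p³ to p⁴.
  cubicSum-p : ∑ℤ p cubicTerm ≈ + 8 * P [ P ^ 4 ]
  cubicSum-p = begin
    ∑ℤ p cubicTerm                                        ≡⟨ cubicSum N ⟩
    + 8 * (+ 2 * + N + 1ℤ) * central N * squareSum N      ≡⟨ ≡-combine (- (+ 4 * squareSum N)) (central-suc N)
                                                              (ring₁ (+ N) P (central N) (central p) (squareSum N)) ⟩
    P * (+ 4 * (central p * squareSum N))                 ≈⟨ ≈-scale P (*-≈ˡ (+ 4) (*-≈ central-p squareSum-p)) ⟩
    P * (+ 4 * (+ 2 * 1ℤ))                                ≡⟨ ℤ.*-comm P (+ 8) ⟩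
    + 8 * P ∎
    where
    open import Relation.Binary.Reasoning.Setoid (≈-setoid (P ^ 4))
    ring₁ : ∀ N P c c′ s → + 8 * (+ 2 * N + 1ℤ) * c * s ≡
      P * (+ 4 * (c′ * s)) + (- (+ 4 * s)) * (P * c′ - + 2 * (+ 2 * N + 1ℤ) * c)
    ring₁ = solve-∀

  -- The sum over k ≤ m

  signedTerm : ℕ → ℤ
  signedTerm i = -1ℤ ^ suc i * ρ (suc i)

  -- Dividing `increment` by (n+1)³, which is prime to `p`, gives the step 2p² (-1)^(n+1)/(n+1)²
  -- modulo p³.
  normalised-≈ : ∀ n q → n ℕ.+ q ≡ N →
    normalised N n q ≈ 1ℤ + + 2 * (P * (P * ∑ℤ n signedTerm)) [ P ^ 3 ]
  normalised-≈ zero    q _     = ≈-reflexive (trans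
    (cong₂ (λ x y → 1ℤ * x * (1ℤ * y * binom (q ℕ.+ 0) 0 + 0ℤ)) (binom-0 N) (binom-0 p))
    (trans (cong (λ x → 1ℤ * 1ℤ * (1ℤ * 1ℤ * x + 0ℤ)) (binom-0 (q ℕ.+ 0))) (ring P)))
    where
    ring : ∀ P → 1ℤ * 1ℤ * (1ℤ * 1ℤ * 1ℤ + 0ℤ) ≡ 1ℤ + + 2 * (P * (P * 0ℤ))
    ring = solve-∀
  normalised-≈ (suc n) q sum≡N = ≈-trans step
    (≈-trans (+-≈ (normalised-≈ n (suc q) n+q≡N) (≈-refl {x = + 2 * (P * (P * signedTerm n))}))
      (≈-reflexive (trans (ring₁ P (∑ℤ n signedTerm) (signedTerm n))
        (cong (λ t → 1ℤ + + 2 * (P * (P * t))) (sym (∑-last n signedTerm))))))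
    where
    open import Relation.Binary.Reasoning.Setoid (≈-setoid (P ^ 3))
    n+q≡N : n ℕ.+ suc q ≡ N
    n+q≡N = trans (ℕ.+-suc n q) sum≡N
    n<N : n < N
    n<N = subst (n <_) sum≡N (s≤s (ℕ.m≤m+n n q))
    A A′ ν s c : ℤ
    A  = normalised N n (suc q)
    A′ = normalised N (suc n) q
    ν  = + suc n
    s  = -1ℤ ^ n
    c  = binom N n
    ring₁ : ∀ P x y → 1ℤ + + 2 * (P * (P * x)) + + 2 * (P * (P * y)) ≡ 1ℤ + + 2 * (P * (P * (x + y)))
    ring₁ = solve-∀
    increment : ν * ν * ν * (A′ - A) ≡ P * P * (c * c * c) * (P - + 2 * ν)
    increment = subst (λ N → ν * ν * ν * (normalised N (suc n) q - normalised N n (suc q)) ≡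
      + suc N * + suc N * (binom N n * binom N n * binom N n) * (+ suc N - + 2 * ν)) n+q≡N (normalised-suc n q)
    p∤ν : ¬ p ∣ ∣ ν ∣
    p∤ν = below-∤ p-prime n<N
    -- Modulo `p`, c³ is (-1)^n and P - 2ν is -2ν. The inserted ν² `ρ` is 1 there and completes the
    -- factor ν³ to be cancelled.
    reduced : c * c * c * (P - + 2 * ν) ≈ ν * (+ 2 * (- 1ℤ * s * (ν * ν * ρ (suc n)))) [ P ^ 1 ]
    reduced = ≈-trans
      (*-≈ (*-≈ (*-≈ c≈s c≈s) c≈s) (+-≈ (p≈0 {p}) (≈-refl {x = - (+ 2 * ν)})))
      (≈-trans (≈-reflexive (trans (cong (λ t → t * s * (0ℤ + - (+ 2 * ν))) (sign-square n)) (ring s ν)))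
        (*-≈ˡ ν (*-≈ˡ (+ 2) (*-≈ˡ (- 1ℤ * s) (≈-sym (ρ-inverse (suc n) p∤ν))))))
      where
      c≈s : c ≈ s [ P ^ 1 ]
      c≈s = binom-≈ p-prime n (ℕ.<⇒≤ n<N)
      ring : ∀ s ν → 1ℤ * s * (0ℤ + - (+ 2 * ν)) ≡ ν * (+ 2 * (- 1ℤ * s * 1ℤ))
      ring = solve-∀
    step : A′ ≈ A + + 2 * (P * (P * signedTerm n)) [ P ^ 3 ]
    step = ≈-cancel p-prime 3 (ν * ν * ν) (∤-* p-prime {ν * ν} {ν} (∤-* p-prime {ν} {ν} p∤ν p∤ν) p∤ν) (begin
      ν * ν * ν * A′
        ≡⟨ ≡-combine 1ℤ increment (ring₂ (ν * ν * ν) A A′ P (c * c * c) (P - + 2 * ν)) ⟩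
      ν * ν * ν * A + P * (P * (c * c * c * (P - + 2 * ν)))
        ≈⟨ +-≈ˡ (ν * ν * ν * A) (≈-scale P (≈-scale P reduced)) ⟩
      ν * ν * ν * A + P * (P * (ν * (+ 2 * (- 1ℤ * s * (ν * ν * ρ (suc n))))))
        ≡⟨ ring₃ ν A P s (ρ (suc n)) ⟩
      ν * ν * ν * (A + + 2 * (P * (P * signedTerm n))) ∎)
      where
      ring₂ : ∀ k A A′ P c d → k * A′ ≡ k * A + P * (P * (c * d)) + 1ℤ * (k * (A′ - A) - P * P * c * d)
      ring₂ = solve-∀
      ring₃ : ∀ ν A P s r → ν * ν * ν * A + P * (P * (ν * (+ 2 * (- 1ℤ * s * (ν * ν * r))))) ≡
        ν * ν * ν * (A + + 2 * (P * (P * (- 1ℤ * s * r))))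
      ring₃ = solve-∀

  m+m≡N : m ℕ.+ m ≡ N
  m+m≡N = cong (λ t → suc (suc t)) (trans (ℕ.+-suc μ (suc μ)) (cong suc (ℕ.+-suc μ μ)))

  cubicSum-half : ∑ℤ (suc m) cubicTerm ≈ + 8 * P + + 16 * (P * (P * (P * ∑ℤ m signedTerm))) [ P ^ 4 ]
  cubicSum-half = begin
    ∑ℤ (suc m) cubicTerm
      ≡⟨ cubicSum m ⟩
    + 8 * (+ 2 * + m + 1ℤ) * central m * squareSum m
      ≡⟨ cong (_*_ (+ 8 * (+ 2 * + m + 1ℤ) * central m)) (squareSum-truncated m) ⟩
    + 8 * (+ 2 * + m + 1ℤ) * central m * (-1ℤ ^ m * truncated (suc (m ℕ.+ m)) m m)
      ≡⟨ ring₁ (+ m) (central m) (-1ℤ ^ m) (truncated (suc (m ℕ.+ m)) m m) ⟩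
    + suc (m ℕ.+ m) * (+ 8 * normalised (m ℕ.+ m) m m)
      ≡⟨ cong (λ t → + suc t * (+ 8 * normalised t m m)) m+m≡N ⟩
    P * (+ 8 * normalised N m m)
      ≈⟨ ≈-scale P (*-≈ˡ (+ 8) (normalised-≈ m m m+m≡N)) ⟩
    P * (+ 8 * (1ℤ + + 2 * (P * (P * ∑ℤ m signedTerm))))
      ≡⟨ ring₂ P (∑ℤ m signedTerm) ⟩
    + 8 * P + + 16 * (P * (P * (P * ∑ℤ m signedTerm))) ∎
    where
    open import Relation.Binary.Reasoning.Setoid (≈-setoid (P ^ 4))
    ring₁ : ∀ m c s t → + 8 * (+ 2 * m + 1ℤ) * c * (s * t) ≡ (1ℤ + (m + m)) * (+ 8 * (s * c * t))
    ring₁ = solve-∀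
    ring₂ : ∀ P x → P * (+ 8 * (1ℤ + + 2 * (P * (P * x)))) ≡ + 8 * P + + 16 * (P * (P * (P * x)))
    ring₂ = solve-∀

  -- As p - 3 is even, the terms at y and -y agree, and `pseudoEuler m e` is 2 (-1)^m 2^(p-3) X for
  -- X the sum of `signedTerm`. So the right side is 64 · 2^(p-3) X, and 4 · 2^(p-3) is 1 modulo
  -- `p`.
  E-half : + 16 * ∑ℤ m signedTerm ≈ + 32 * (-1ℤ ^ m * E e) [ P ^ 1 ]
  E-half = ≈-sym (≈-trans (*-≈ˡ (+ 32) (*-≈ˡ (-1ℤ ^ m) E≈))
    (≈-trans (≈-reflexive (≡-combine (+ 64 * (ρ 2 * X)) (sign-square m)
      (≡-combine (+ 32 * (-1ℤ ^ m * -1ℤ ^ m)) (even m) (ring₁ (-1ℤ ^ m) (ρ 2) X (symmetricSum m (λ y → (+ 2 * y) ^ e))))))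
      (≈-combine (+ 16 * X) 0ℤ (ρ-inverse 2 p∤2) (ring₂ (ρ 2) X P))))
    where
    X : ℤ
    X = ∑ℤ m signedTerm
    p∤2 : ¬ p ∣ 2
    p∤2 = below-∤ p-prime (s≤s (s≤s z≤n))
    E≈ : E e ≈ pseudoEuler m e [ P ^ 1 ]
    E≈ = subst (λ n → E e ≈ pseudoEuler m e [ (+ suc n) ^ 1 ]) m+m≡N
      (E-≈ m (subst (Prime ∘ suc) (sym m+m≡N) p-prime) (subst (λ n → ¬ suc n ∣ 2) (sym m+m≡N) p∤2) e)
    even : ∀ n → symmetricSum n (λ y → (+ 2 * y) ^ e) ≡ + 2 * (ρ 2 * ∑ℤ n signedTerm)
    -- The middle term `0 ^ e` vanishes because `e` is positive.
    even zero    = ring (ρ 2)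
      where
      ring : ∀ r → 0ℤ ≡ + 2 * (r * 0ℤ)
      ring = solve-∀
    even (suc n) = begin
      symmetricSum n (λ y → (+ 2 * y) ^ e) + -1ℤ ^ suc n * ((+ 2 * + suc n) ^ e + (+ 2 * - + suc n) ^ e)
        ≡⟨ cong₂ (λ u v → u + -1ℤ ^ suc n * v) (even n) (cong₂ _+_ positive negative) ⟩
      + 2 * (ρ 2 * ∑ℤ n signedTerm) + -1ℤ ^ suc n * (ρ 2 * ρ (suc n) + ρ 2 * ρ (suc n))
        ≡⟨ ring (ρ 2) (∑ℤ n signedTerm) (-1ℤ ^ suc n) (ρ (suc n)) ⟩
      + 2 * (ρ 2 * (∑ℤ n signedTerm + signedTerm n))
        ≡⟨ cong (λ t → + 2 * (ρ 2 * t)) (∑-last n signedTerm) ⟨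
      + 2 * (ρ 2 * ∑ℤ (suc n) signedTerm) ∎
      where
      open ≡-Reasoning
      positive : (+ 2 * + suc n) ^ e ≡ ρ 2 * ρ (suc n)
      positive = ^-distrib-* (+ 2) (+ suc n) e
      negative : (+ 2 * - + suc n) ^ e ≡ ρ 2 * ρ (suc n)
      negative = trans (^-distrib-* (+ 2) (- + suc n) e) (cong (_*_ (ρ 2))
        (trans (cong (λ t → (- + suc n) ^ suc t) (sym (ℕ.+-suc μ μ)))
          (trans (neg-^-double (+ suc n) (suc μ)) (cong (λ t → (+ suc n) ^ suc t) (ℕ.+-suc μ μ)))))
      ring : ∀ r X s t → + 2 * (r * X) + s * (r * t + r * t) ≡ + 2 * (r * (X + s * t))
      ring = solve-∀
    ring₁ : ∀ s r X T → + 32 * (s * (s * T)) ≡ + 64 * (r * X)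
      + + 64 * (r * X) * (s * s - 1ℤ) + + 32 * (s * s) * (T - + 2 * (r * X))
    ring₁ = solve-∀
    ring₂ : ∀ r X P → + 64 * (r * X) ≡ + 16 * X + + 16 * X * (+ 2 * + 2 * r - 1ℤ) + 0ℤ * (P * 1ℤ)
    ring₂ = solve-∀

  -- The terms with k > m

  odd-∤ : ∀ {k} → k < m → ¬ p ∣ ∣ + 2 * + k + 1ℤ ∣
  odd-∤ {k} k<m = subst (λ t → ¬ p ∣ ∣ t ∣) (ring (+ k)) (below-∤ p-prime (ℕ.<-≤-trans (ℕ.+-mono-< k<m k<m) (ℕ.≤-reflexive m+m≡N)))
    where
    ring : ∀ k → 1ℤ + (k + k) ≡ + 2 * k + 1ℤ
    ring = solve-∀

  -- The recursion of `central` introduces into its numerator only 2 and the odd numbers 2k + 1 < p.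
  central-∤ : ∀ k → k ≤ m → ¬ p ∣ ∣ central k ∣
  central-∤ zero    _   = subst (λ t → ¬ p ∣ ∣ t ∣) (sym (binom-0 0)) (>⇒∤ (s≤s (s≤s z≤n)))
  central-∤ (suc k) k<m p∣c = ∤-* p-prime {+ 2 * (+ 2 * + k + 1ℤ)} {central k}
    (∤-* p-prime {+ 2} {+ 2 * + k + 1ℤ} (below-∤ p-prime (s≤s (s≤s z≤n))) (odd-∤ k<m))
    (central-∤ k (ℕ.<⇒≤ k<m))
    (subst (λ t → p ∣ ∣ t ∣) (central-suc k)
      (subst (p ∣_) (sym (ℤ.abs-* (+ suc k) (central (suc k)))) (∣n⇒∣m*n (suc k) p∣c)))

  -- Passing from the pair (K, Q+1) to (K+1, Q) multiplies the product by (2K+1)(Q+1)/((2Q+1)K).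
  -- With K + Q + 1 = p this is 1 modulo `p`, which preserves a value modulo p² that is already
  -- divisible by `p`.
  reflection : ∀ k q → k < m → suc k ℕ.+ suc q ≡ p →
    + suc k * central (suc k) * central (suc q) ≈ - (+ 2 * P) [ P ^ 2 ]
  reflection zero    q _ eq with refl ← ℕ.suc-injective eq =
    ≈-cancel p-prime 2 d p∤d
      (≈-trans (≈-reflexive (≡-combine (- 1ℤ) (central-suc N)
        (≡-combine (d * central N) central-1 (ring₁ (+ N) P (central 1) (central N) (central p)))))
      (≈-trans (≈-scale P (≈-weaken {P} {P ^ 1} (≈-weaken {P} {P ^ 2} (central-p))))
        -- The start is C(2p,p) ≡ 2, and 2p = (2p-1)(-2p) + 4p².
        (+ 4 , ring₂ (+ N))))
    where
    d : ℤ
    d = + 2 * + N + 1ℤ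
    p∤d : ¬ p ∣ ∣ d ∣
    p∤d = ∤-≈ {p} {d} { -1ℤ} (+ 2 , ring (+ N)) (>⇒∤ (s≤s (s≤s z≤n)))
      where
      ring : ∀ N → + 2 * N + 1ℤ ≡ - 1ℤ + + 2 * ((1ℤ + N) * 1ℤ)
      ring = solve-∀
    central-1 : central 1 ≡ + 2
    central-1 = binom-1 2
    ring₁ : ∀ N P c c′ c″ → (+ 2 * N + 1ℤ) * (1ℤ * c * c′) ≡ P * c″
      + (- 1ℤ) * (P * c″ - + 2 * (+ 2 * N + 1ℤ) * c′) + (+ 2 * N + 1ℤ) * c′ * (c - + 2)
    ring₁ = solve-∀
    ring₂ : ∀ N → (1ℤ + N) * + 2 ≡ (+ 2 * N + 1ℤ) * (- (+ 2 * (1ℤ + N))) + + 4 * ((1ℤ + N) * ((1ℤ + N) * 1ℤ))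
    ring₂ = solve-∀
  reflection (suc k) q sk<m eq = ≈-cancel p-prime 2 d p∤d
    (≈-trans (≈-reflexive (≡-combine ((+ 2 * Q + 1ℤ) * K * cQ) (central-suc (suc k))
      (≡-combine (- (K * (+ 2 * K + 1ℤ) * cK)) (central-suc (suc q))
        (ring₁ K Q cK (central (suc (suc k))) cQ (central (suc (suc q)))))))
    (≈-trans (*-≈ˡ ((+ 2 * K + 1ℤ) * (1ℤ + Q)) (reflection k (suc q) (ℕ.<⇒≤ sk<m) (trans (ℕ.+-suc (suc k) (suc q)) eq)))
      (- + 2 , ≡-combine (- (+ 2 * P)) (cong +_ eq) (ring₂ K Q P))))
    where
    K Q cK cQ d : ℤ
    K = + suc k
    Q = + suc q
    cK = central (suc k)
    cQ = central (suc q)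
    d = (+ 2 * Q + 1ℤ) * K
    p∤d : ¬ p ∣ ∣ d ∣
    p∤d = ∤-* p-prime {+ 2 * Q + 1ℤ} {K}
      (∤-≈ {p} {+ 2 * Q + 1ℤ} { - (+ 2 * K + 1ℤ)} (+ 2 , ≡-combine (+ 2) (cong +_ eq) (ring K Q P))
        (subst (λ t → ¬ p ∣ t) (sym (ℤ.∣-i∣≡∣i∣ (+ 2 * K + 1ℤ))) (odd-∤ sk<m)))
      (below-∤ p-prime (ℕ.<-≤-trans (ℕ.<⇒≤ sk<m) (ℕ.m+n≤o⇒m≤o m (ℕ.≤-reflexive m+m≡N))))
      where
      ring : ∀ K Q P → + 2 * Q + 1ℤ ≡ - (+ 2 * K + 1ℤ) + + 2 * (P * 1ℤ) + + 2 * (1ℤ + K + Q - P)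
      ring = solve-∀
    ring₁ : ∀ K Q c c′ d d′ → (+ 2 * Q + 1ℤ) * K * ((1ℤ + K) * c′ * d) ≡
      (+ 2 * K + 1ℤ) * (1ℤ + Q) * (K * c * d′)
      + (+ 2 * Q + 1ℤ) * K * d * ((1ℤ + K) * c′ - + 2 * (+ 2 * K + 1ℤ) * c)
      + (- (K * (+ 2 * K + 1ℤ) * c)) * ((1ℤ + Q) * d′ - + 2 * (+ 2 * Q + 1ℤ) * d)
    ring₁ = solve-∀
    ring₂ : ∀ K Q P → (+ 2 * K + 1ℤ) * (1ℤ + Q) * (- (+ 2 * P)) ≡
      (+ 2 * Q + 1ℤ) * K * (- (+ 2 * P)) + (- + 2) * (P * (P * 1ℤ)) + (- (+ 2 * P)) * (1ℤ + K + Q - P)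
    ring₂ = solve-∀

  -- This is b^(p-2), the inverse of b modulo `p`.
  ι : ℕ → ℤ
  ι b = + b * ρ b

  ι-inverse : ∀ b → ¬ p ∣ b → + b * ι b ≈ 1ℤ [ P ^ 1 ]
  ι-inverse b p∤b = ≈-trans (≈-reflexive (sym (ℤ.*-assoc (+ b) (+ b) (ρ b)))) (ρ-inverse b p∤b)


  base-∤ : ∀ {k} → k < m → ¬ p ∣ base k
  base-∤ {k} k<m = subst (λ t → ¬ p ∣ ∣ t ∣) (sym (base-≡ k)) (∤-* p-prime {+ suc k} {central (suc k)}
    (below-∤ p-prime (ℕ.<-≤-trans k<m (ℕ.m+n≤o⇒m≤o m (ℕ.≤-reflexive m+m≡N)))) (central-∤ (suc k) k<m))

  -- The integer representing `reciprocalTerm (suc k)` modulo `p`.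
  reciprocal : ℕ → ℤ
  reciprocal k = (+ 21 * + suc k - + 8) * (ι (base k) * ι (base k) * ι (base k))

  cubicTerm-reflection : ∀ k q → k < m → suc k ℕ.+ suc q ≡ p →
    cubicTerm (suc q) ≈ P * (P * (P * (+ 8 * reciprocal k))) [ P ^ 4 ]
  cubicTerm-reflection k q k<m eq = cube-lift P (+ suc k) (+ suc q) (central (suc q)) (+ base k) (ι (base k))
    (cong +_ eq) (≈-cancel p-prime 1 {central (suc q)} {0ℤ} (+ base k) (base-∤ k<m) base*c≈0)
    base*c≈ (ι-inverse (base k) (base-∤ k<m))
    where
    base*c≈ : + base k * central (suc q) ≈ - (+ 2 * P) [ P ^ 2 ]
    base*c≈ = ≈-trans (≈-reflexive (cong (_* central (suc q)) (base-≡ k))) (reflection k q k<m eq)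
    base*c≈0 : + base k * central (suc q) ≈ + base k * 0ℤ [ P ^ 1 ]
    base*c≈0 = ≈-trans (≈-weaken {P} {P ^ 1} base*c≈) (- + 2 , ring (+ base k) P)
      where
      ring : ∀ b P → - (+ 2 * P) ≡ b * 0ℤ + (- + 2) * (P * 1ℤ)
      ring = solve-∀

  -- Comparing the full sum with its lower half gives 8Z ≡ -16X ≡ -32 (-1)^m E_{p-3}, and 8 is
  -- cancelled.
  reciprocal-sum : ∑ℤ m reciprocal ≈ -1ℤ ^ suc m * + 4 * E e [ P ^ 1 ]
  reciprocal-sum = ≈-cancel p-prime 1 (+ 8) (∤-* p-prime {+ 4} {+ 2}
      (below-∤ p-prime (s≤s (s≤s (s≤s (s≤s z≤n))))) (below-∤ p-prime (s≤s (s≤s z≤n))))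
    (≈-trans (upper-half P X Z splitting (cubicSum-p) (cubicSum-half) top)
    (≈-combine (- 1ℤ) 0ℤ E-half (ring X (-1ℤ ^ m) (E e) P)))
    where
    X Z S : ℤ
    X = ∑ℤ m signedTerm
    Z = ∑ℤ m reciprocal
    S = ∑ℤ (suc m) cubicTerm
    ring : ∀ X s E P → - (+ 16 * X) ≡ + 8 * (- 1ℤ * s * + 4 * E)
      + (- 1ℤ) * (+ 16 * X - + 32 * (s * E)) + 0ℤ * (P * 1ℤ)
    ring = solve-∀
    p∸m≡1+m : p ∸ m ≡ suc m
    p∸m≡1+m = trans (cong (λ t → suc t ∸ m) (sym m+m≡N)) (ℕ.m+n∸n≡m (suc m) m)
    top : (∑ℤ[ k < m ] cubicTerm (N ∸ k)) ≈ P * (P * (P * (+ 8 * Z))) [ P ^ 4 ]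
    top = ≈-trans
      (∑-≈ m {λ k → cubicTerm (N ∸ k)} {λ k → P * (P * (P * (+ 8 * reciprocal k)))} λ k k<m →
        ≈-trans (≈-reflexive (cong cubicTerm (N∸k≡ k k<m)))
          (cubicTerm-reflection k (N ∸ suc k) k<m (trans (cong (ℕ._+_ (suc k)) (sym (N∸k≡ k k<m)))
            (cong suc (ℕ.m+[n∸m]≡n (ℕ.<⇒≤ (k<N k<m)))))))
      (≈-reflexive (trans (∑-*ˡ m P (λ k → P * (P * (+ 8 * reciprocal k)))) (cong (_*_ P)
        (trans (∑-*ˡ m P (λ k → P * (+ 8 * reciprocal k))) (cong (_*_ P)
          (trans (∑-*ˡ m P (λ k → + 8 * reciprocal k)) (cong (_*_ P) (∑-*ˡ m (+ 8) reciprocal))))))))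
      where
      k<N : ∀ {k} → k < m → k < N
      k<N k<m = ℕ.<-≤-trans k<m (ℕ.m+n≤o⇒m≤o m (ℕ.≤-reflexive m+m≡N))
      N∸k≡ : ∀ k → k < m → N ∸ k ≡ suc (N ∸ suc k)
      N∸k≡ k k<m = sym (trans (sym (ℕ.+-∸-assoc 1 (k<N k<m))) refl)
    splitting : ∑ℤ p cubicTerm ≡ S + (∑ℤ[ k < m ] cubicTerm (N ∸ k))
    splitting = trans (∑-top N m cubicTerm (ℕ.<⇒≤ (s≤s (ℕ.m+n≤o⇒m≤o m (ℕ.≤-reflexive m+m≡N)))))
      (cong (λ t → ∑ℤ t cubicTerm + (∑ℤ[ k < m ] cubicTerm (N ∸ k))) p∸m≡1+m)

  -- The two congruences in the rationals

  -- `h` stands for `(p ∸ 1) / 2`, which equals `m` by a proof and not by computation.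
  lower-congruence : ∀ h → h ≡ m →
    fromℤ (∑ℤ[ k < suc h ] ((+ 21 * + k + + 8) * (+ ((2 ℕ.* k) C k)) ^ 3))
      ≡ fromℤ (+ 8 * + p + -1ℤ ^ h * + 32 * (+ p) ^ 3 * E (p ∸ 3)) [mod p ^ 4 ]
  lower-congruence h refl = fromℤ-≈ p-prime 4
    (≈-trans (≈-reflexive (∑-cong (suc m) λ k _ → cubicTerm-C k))
      (lower-half (+ p) (∑ℤ m (signedTerm)) (-1ℤ ^ m) (E (p ∸ 3))
        (cubicSum-half) (E-half)))

  denominator-≡ : ∀ j → suc j ℕ.^ 3 ℕ.* ((2 ℕ.* suc j) C suc j) ℕ.^ 3
    ≡ base j ℕ.* base j ℕ.* base j
  denominator-≡ j = trans (cong (λ n → suc j ℕ.^ 3 ℕ.* (n C suc j) ℕ.^ 3) (cong (suc j ℕ.+_) (ℕ.+-identityʳ (suc j))))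
    (trans (ring (suc j) ((suc j ℕ.+ suc j) C suc j)) (cong (λ b → b ℕ.* b ℕ.* b) (sym (base-C j))))
    where
    ring : ∀ a c → (a ℕ.* (a ℕ.* (a ℕ.* 1))) ℕ.* (c ℕ.* (c ℕ.* (c ℕ.* 1))) ≡ (a ℕ.* c) ℕ.* (a ℕ.* c) ℕ.* (a ℕ.* c)
    ring = ℕRing.solve-∀

  reciprocalTerm-≈ : ∀ j → j < m → reciprocalTerm (suc j) ≡ fromℤ (reciprocal j) [mod p ^ 1 ]
  reciprocalTerm-≈ j j<m = /-≈ p-prime 1 (+ 21 * + suc j - + 8) (suc j ℕ.^ 3 ℕ.* ((2 ℕ.* suc j) C suc j) ℕ.^ 3)
    (reciprocal j)
    (subst (λ d → ¬ p ∣ d) (sym (denominator-≡ j)) p∤base³)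
    (subst (λ d → + d * reciprocal j ≈ + 21 * + suc j - + 8 [ (+ p) ^ 1 ]) (sym (denominator-≡ j))
      (≈-trans (≈-reflexive (cong (_* reciprocal j) (pos-cube (base j))))
        (cube-inverse (+ base j) (ι (base j)) (+ 21 * + suc j - + 8)
          (ι-inverse (base j) p∤base))))
    where
    -- The instances local to `reciprocalTerm` are rebuilt; they are irrelevant arguments, so the
    -- fractions coincide.
    instance
      _ = nCk≢0 (ℕ.m≤m+n (suc j) (suc j ℕ.+ 0))
      _ = ℕ.m^n≢0 (suc j) 3
      _ = ℕ.m^n≢0 ((2 ℕ.* suc j) C suc j) 3
      _ = ℕ.m*n≢0 (suc j ℕ.^ 3) (((2 ℕ.* suc j) C suc j) ℕ.^ 3)
    p∤base : ¬ p ∣ base j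
    p∤base = base-∤ j<m
    p∤base³ : ¬ p ∣ base j ℕ.* base j ℕ.* base j
    p∤base³ p∣ = [ [ p∤base , p∤base ]′ ∘ euclidsLemma (base j) (base j) p-prime , p∤base ]′
      (euclidsLemma (base j ℕ.* base j) (base j) p-prime p∣)
    pos-cube : ∀ b → + (b ℕ.* b ℕ.* b) ≡ + b * + b * + b
    pos-cube b = trans (ℤ.pos-* (b ℕ.* b) b) (cong (_* + b) (ℤ.pos-* b b))

  upper-congruence : ∀ h h′ → h ≡ m → h′ ≡ suc m →
    ∑ℚ[ j < h ] reciprocalTerm (suc j) ≡ fromℤ (-1ℤ ^ h′ * + 4 * E (p ∸ 3)) [mod p ^ 1 ]
  upper-congruence h h′ refl refl = mod-trans p-prime {1} {∑ℚ[ j < m ] reciprocalTerm (suc j)}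
    {fromℤ (∑ℤ m (reciprocal))} {fromℤ (-1ℤ ^ suc m * + 4 * E (p ∸ 3))}
    (∑ℚ-≈ p-prime 1 m {λ j → reciprocalTerm (suc j)} {reciprocal} reciprocalTerm-≈)
    (fromℤ-≈ p-prime 1 (reciprocal-sum))

theorem1p4 : ∀ (p : ℕ) → Prime p → 3 < p →
    (fromℤ (∑ℤ[ k < suc ((p ∸ 1) / 2) ] ((+ 21 * + k + + 8) * (+ ((2 ℕ.* k) C k)) ^ 3))
    ≡ fromℤ (+ 8 * + p + -1ℤ ^ ((p ∸ 1) / 2) * + 32 * (+ p) ^ 3 * E (p ∸ 3))
    [mod p ^ 4 ])
    ×
    (∑ℚ[ j < (p ∸ 1) / 2 ] reciprocalTerm (suc j)
    ≡ fromℤ (-1ℤ ^ ((p ℕ.+ 1) / 2) * + 4 * E (p ∸ 3))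
    [mod p ^ 1 ])
theorem1p4 p p-prime 3<p with odd-prime p p-prime 3<p
... | μ , refl = lower-congruence μ p-prime _ half , upper-congruence μ p-prime _ _ half half′
  where
  half : (4 ℕ.+ (μ ℕ.+ μ)) / 2 ≡ 2 ℕ.+ μ
  half = trans (cong (_/ 2) (sym (m+m≡N μ p-prime))) (double/2 (2 ℕ.+ μ))
  half′ : (5 ℕ.+ (μ ℕ.+ μ) ℕ.+ 1) / 2 ≡ 3 ℕ.+ μ
  half′ = trans (cong (_/ 2) (ring μ)) (double/2 (3 ℕ.+ μ))
    where
    ring : ∀ μ → 5 ℕ.+ (μ ℕ.+ μ) ℕ.+ 1 ≡ (3 ℕ.+ μ) ℕ.+ (3 ℕ.+ μ)
    ring = ℕRing.solve-∀
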